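{- Let $d\ge0$. Consider the Schubert matroids $\mathrm{SM}(A)$ for all subsets $A\subseteq[d]$ such that $A\ne\{1,2,\dots,k\}$ for every $k=0,1,\dots,d-1$ (where $k=0$ gives the empty set; $A=[d]$ is allowed). Then the corresponding chromatic word-quasisymmetric functions $\Psi(\mathrm{SM}(A))$ are linearly independent. Therefore the rank of the degree-$d$ component $\Psi_d\colon\mathrm{Mat}_d\to\mathrm{WQSym}_d$ of $\Psi$ is at least $2^d-d$.
   Context: $[d]=\{1,\dots,d\}$, $[0]=\emptyset$. For a matroid $M$ on $[d]$, $f\colon[d]\to\mathbb R$ and a basis $B$ put $f(B)=\sum_{i\in B}f(i)$; $f$ is $M$-generic if there is a unique basis $B$ of $M$ maximizing $f(B)$. Let $w_1,w_2,\dots$ be non-commuting variables and $w_f=w_{f(1)}\cdots w_{f(d)}$ for $f\colon[d]\to\mathbb Z_{\ge1}$. The chromatic word-quasisymmetric function of $M$ is $\Psi(M)=\sum_{f} w_f$, the sum over all $M$-generic $f\colon[d]\to\mathbb Z_{\ge 1}$. The set composition type of $f$ is the ordered partition of $[d]$ into the level sets of $f$, listed by increasing value. $\mathrm{WQSym}_d$ is the real vector space of formal series $\sum_{f:[d]\to\mathbb Z_{\ge1}}c_fw_f$ with $c_f=c_g$ whenever $f,g$ have the same set composition type. $\mathrm{Mat}_d$ is the real vector space with basis all matroids on $[d]$, and $\Psi_d$ is the linear extension of $M\mapsto\Psi(M)$. For $A=\{a_1<\dots<a_r\}\subseteq[d]$, the Schubert matroid $\mathrm{SM}(A)$ is the matroid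 on $[d]$ whose bases are the sets $B=\{b_1<\dots<b_r\}\subseteq[d]$ with $b_i\le a_i$ for all $i=1,\dots,r$. -}

module Defs where

open import Algebra.Bundles using (CommutativeRing; Ring)
open import Algebra.Structures using (IsCommutativeRing)
import Algebra.Properties.Group as GroupProperties
open import Algebra.Module.Bundles using (LeftModule)
open import Algebra.Module.Morphism.Structures using (IsLeftModuleHomomorphism)
import Algebra.Properties.CommutativeMonoid.Sum as MonoidSum
open import Data.Rational as Rat using (ℚ; 0ℚ; 1ℚ; ½; 1/_; positive)
import Data.Rational.Properties as ℚₚ
open import Relation.Binary.Structures using (IsEquivalence)
open import Level using (Level; 0ℓ; _⊔_)
open import Data.Nat.Base as Nat using (ℕ; zero; suc; z≤n; s≤s)
import Data.Nat.Properties as ℕₚ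
open import Data.Nat.Induction using (<-wellFounded)
open import Induction.WellFounded using (Acc; acc)
open import Data.Nat.ListAction using (sum)
open import Data.Bool.Base using (Bool; true; false; if_then_else_; T)
import Data.Bool.Properties as Boolₚ
open import Data.Empty using (⊥-elim)
open import Data.Fin.Base as Fin using (Fin; zero; suc; toℕ)
import Data.Fin.Properties as Finₚ
open import Data.Fin.Subset using (Subset; inside; outside; _∈_; _∉_; _∪_; _─_; ⊥; ⁅_⁆)
import Data.Fin.Subset as Sub
import Data.Fin.Subset.Properties as Subₚ
open import Data.List.Base as List using (List; []; _∷_; filter; upTo)
import Data.List.Properties as Listₚ
open import Data.List.Extrema.Nat using (max; xs≤max)
open import Data.List.Membership.Propositional using () renaming (_∈_ to _∈ₗ_)
open import Data.List.Membership.Propositional.Properties using (∈-upTo⁺)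
open import Data.List.Relation.Unary.All as All using (All; []; _∷_)
import Data.List.Relation.Unary.All.Properties as Allₚ
open import Data.List.Relation.Unary.Any using (here; there)
open import Data.List.Relation.Unary.AllPairs using (AllPairs; []; _∷_)
import Data.List.Relation.Unary.AllPairs.Properties as AllPairsₚ
open import Data.List.Relation.Binary.Pointwise as Pointwise using (Pointwise; []; _∷_)
open import Data.Product using (∃; ∃!; _×_; _,_; proj₁; proj₂)
open import Data.Refinement using (Refinement; value; Refinement-syntax)
open import Data.Sum.Base using (_⊎_; inj₁; inj₂)
open import Data.Vec.Base as Vec using ([]; _∷_; here; there)
import Data.Vec.Properties as Vecₚ
open import Function.Base using (_∘_)
open import Function.Bundles using (mk⇔)
open import Function.Definitions using (Injective)
open import Relation.Binary.Bundles using (Setoid)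
open import Relation.Binary.PropositionalEquality using (_≡_; _≢_; refl; sym; trans; cong; cong₂; subst; subst₂)
open import Relation.Nullary.Decidable.Core using (Dec; yes; no; does; ⌊_⌋; ¬?; _×-dec_; _⊎-dec_; _→-dec_; T?; toWitness; fromWitness; decidable-stable)
open import Relation.Nullary.Decidable using (map′; does-⇔; dec-true; dec-false)
open import Relation.Nullary.Negation using (¬_)
open import Relation.Unary using (Decidable)

-- The real numbers: Cauchy sequences of rationals, where two sequences are equal when
-- their difference tends to zero.
module CauchyReals where

  open Rat using (∣_∣; _+_; _*_; -_; _-_; _<_; _≤_)

  Cauchy : (ℕ → ℚ) → Set
  Cauchy x = ∀ ε → 0ℚ < ε → ∃ λ N → ∀ m n → N Nat.≤ m → N Nat.≤ n → ∣ x m - x n ∣ < ε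

  record ℝ : Set where
    constructor real
    field
      seq    : ℕ → ℚ
      cauchy : Cauchy seq

  open ℝ public

  infix 4 _≈_
  record _≈_ (x y : ℝ) : Set where
    constructor close
    field
      eventually : ∀ ε → 0ℚ < ε → ∃ λ N → ∀ n → N Nat.≤ n → ∣ seq x n - seq y n ∣ < ε

  private

    +-interchange : ∀ a b c e → (a + b) + (c + e) ≡ (a + c) + (b + e)
    +-interchange a b c e = trans (ℚₚ.+-assoc a b (c + e))
      (trans (cong (a +_) (trans (sym (ℚₚ.+-assoc b c e))
        (trans (cong (_+ e) (ℚₚ.+-comm b c)) (ℚₚ.+-assoc c b e))))
      (sym (ℚₚ.+-assoc a c (b + e))))

    sub-+ : ∀ a b c e → (a - b) + (c - e) ≡ (a + c) - (b + e)
    sub-+ a b c e = trans (+-interchange a (- b) c (- e))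
      (cong ((a + c) +_) (sym (ℚₚ.neg-distrib-+ b e)))

    sub-telescope : ∀ a b c → (a - b) + (b - c) ≡ a - c
    sub-telescope a b c = trans (ℚₚ.+-assoc a (- b) (b - c)) (cong (a +_)
      (trans (sym (ℚₚ.+-assoc (- b) b (- c)))
        (trans (cong (_- c) (ℚₚ.+-inverseˡ b)) (ℚₚ.+-identityˡ (- c)))))

    add-sub : ∀ a c → c + (a - c) ≡ a
    add-sub a c = trans (ℚₚ.+-comm c (a - c)) (trans (ℚₚ.+-assoc a (- c) c)
      (trans (cong (a +_) (ℚₚ.+-inverseˡ c)) (ℚₚ.+-identityʳ a)))

    neg-sub : ∀ a b → - (a - b) ≡ (- a) - (- b)
    neg-sub a b = ℚₚ.neg-distrib-+ a (- b)

    neg-swap : ∀ a b → - (a - b) ≡ b - a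
    neg-swap a b = trans (neg-sub a b) (trans (ℚₚ.+-comm (- a) (- (- b)))
      (cong (_- a) (GroupProperties.⁻¹-involutive ℚₚ.+-0-group b)))

    *-sub : ∀ a c e → a * (c - e) ≡ a * c - a * e
    *-sub a c e = trans (ℚₚ.*-distribˡ-+ a c (- e)) (cong (a * c +_) (sym (ℚₚ.neg-distribʳ-* a e)))

    sub-* : ∀ a b c e → a * (c - e) + e * (a - b) ≡ a * c - b * e
    sub-* a b c e = trans
      (cong₂ _+_ (*-sub a c e)
        (trans (*-sub e a b) (cong₂ (λ u v → u - v) (ℚₚ.*-comm e a) (ℚₚ.*-comm e b))))
      (sub-telescope (a * c) (a * e) (b * e))

    Small : (ℕ → ℕ → ℚ) → Set
    Small u = ∀ ε → 0ℚ < ε → ∃ λ N → ∀ m n → N Nat.≤ m → N Nat.≤ n → ∣ u m n ∣ < ε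

    Bounded : (ℕ → ℕ → ℚ) → Set
    Bounded u = ∃ λ K → 0ℚ < K × ∃ λ N → ∀ m n → N Nat.≤ m → N Nat.≤ n → ∣ u m n ∣ < K

    small-resp : ∀ {u v} → (∀ m n → u m n ≡ v m n) → Small u → Small v
    small-resp u≡v su ε ε>0 with su ε ε>0
    ... | N , h = N , λ m n p q → subst (λ z → ∣ z ∣ < ε) (u≡v m n) (h m n p q)

    half>0 : ∀ {ε} → 0ℚ < ε → 0ℚ < ε * ½
    half>0 {ε} ε>0 = ℚₚ.*-monoˡ-<-pos ½ ε>0

    halves : ∀ ε → ε * ½ + ε * ½ ≡ ε
    halves ε = trans (sym (ℚₚ.*-distribˡ-+ ε ½ ½)) (ℚₚ.*-identityʳ ε)

    small-+ : ∀ {u v} → Small u → Small v → Small (λ m n → u m n + v m n)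
    small-+ {u} {v} su sv ε ε>0 with su (ε * ½) (half>0 ε>0) | sv (ε * ½) (half>0 ε>0)
    ... | N , h | N′ , h′ = N Nat.⊔ N′ , λ m n p q → ℚₚ.≤-<-trans
      (ℚₚ.∣p+q∣≤∣p∣+∣q∣ (u m n) (v m n))
      (subst (∣ u m n ∣ + ∣ v m n ∣ <_) (halves ε)
        (ℚₚ.+-mono-<
          (h m n (ℕₚ.≤-trans (ℕₚ.m≤m⊔n N N′) p) (ℕₚ.≤-trans (ℕₚ.m≤m⊔n N N′) q))
          (h′ m n (ℕₚ.≤-trans (ℕₚ.m≤n⊔m N N′) p) (ℕₚ.≤-trans (ℕₚ.m≤n⊔m N N′) q))))

    small-neg : ∀ {u} → Small u → Small (λ m n → - u m n)
    small-neg {u} su ε ε>0 with su ε ε>0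
    ... | N , h = N , λ m n p q → subst (_< ε) (sym (ℚₚ.∣-p∣≡∣p∣ (u m n))) (h m n p q)

    small-* : ∀ {b u} → Bounded b → Small u → Small (λ m n → b m n * u m n)
    small-* {b} {u} (K , K>0 , N , h) su ε ε>0 = bound (su (1/ K * ε) δ>0)
      where
      instance
        K-pos : Rat.Positive K
        K-pos = positive K>0
        K-nz : Rat.NonZero K
        K-nz = ℚₚ.pos⇒nonZero K
        1/K-pos : Rat.Positive (1/ K)
        1/K-pos = ℚₚ.1/pos⇒pos K

      δ>0 : 0ℚ < 1/ K * ε
      δ>0 = subst (_< 1/ K * ε) (ℚₚ.*-zeroʳ (1/ K)) (ℚₚ.*-monoʳ-<-pos (1/ K) ε>0)

      Kδ≡ε : K * (1/ K * ε) ≡ ε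
      Kδ≡ε = trans (sym (ℚₚ.*-assoc K (1/ K) ε))
        (trans (cong (_* ε) (ℚₚ.*-inverseʳ K)) (ℚₚ.*-identityˡ ε))

      bound : (∃ λ N′ → ∀ m n → N′ Nat.≤ m → N′ Nat.≤ n → ∣ u m n ∣ < 1/ K * ε) →
              ∃ λ M → ∀ m n → M Nat.≤ m → M Nat.≤ n → ∣ b m n * u m n ∣ < ε
      bound (N′ , h′) = N Nat.⊔ N′ , λ m n p q →
        subst₂ _<_ (sym (ℚₚ.∣p*q∣≡∣p∣*∣q∣ (b m n) (u m n))) Kδ≡ε
          (ℚₚ.≤-<-trans
            (ℚₚ.*-monoʳ-≤-nonNeg ∣ u m n ∣ {{ℚₚ.∣-∣-nonNeg (u m n)}}
              (ℚₚ.<⇒≤ (h m n (ℕₚ.≤-trans (ℕₚ.m≤m⊔n N N′) p) (ℕₚ.≤-trans (ℕₚ.m≤m⊔n N N′) q))))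
            (ℚₚ.*-monoʳ-<-pos K
              (h′ m n (ℕₚ.≤-trans (ℕₚ.m≤n⊔m N N′) p) (ℕₚ.≤-trans (ℕₚ.m≤n⊔m N N′) q))))

    1>0 : 0ℚ < 1ℚ
    1>0 = ℚₚ.positive⁻¹ 1ℚ

    bounded : ∀ x → ∃ λ K → 0ℚ < K × ∃ λ N → ∀ n → N Nat.≤ n → ∣ seq x n ∣ < K
    bounded x with cauchy x 1ℚ 1>0
    ... | N , h = ∣ seq x N ∣ + 1ℚ
                , ℚₚ.+-mono-≤-< (ℚₚ.0≤∣p∣ (seq x N)) 1>0
                , N
                , λ n N≤n → ℚₚ.≤-<-trans (tri n) (ℚₚ.+-monoʳ-< ∣ seq x N ∣ (h n N N≤n ℕₚ.≤-refl))
      where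
      tri : ∀ n → ∣ seq x n ∣ ≤ ∣ seq x N ∣ + ∣ seq x n - seq x N ∣
      tri n = subst (λ z → ∣ z ∣ ≤ ∣ seq x N ∣ + ∣ seq x n - seq x N ∣)
        (add-sub (seq x n) (seq x N))
        (ℚₚ.∣p+q∣≤∣p∣+∣q∣ (seq x N) (seq x n - seq x N))

    bounded₁ : ∀ x → Bounded (λ m n → seq x m)
    bounded₁ x with bounded x
    ... | K , K>0 , N , h = K , K>0 , N , λ m n p q → h m p

    bounded₂ : ∀ x → Bounded (λ m n → seq x n)
    bounded₂ x with bounded x
    ... | K , K>0 , N , h = K , K>0 , N , λ m n p q → h n q

    small⇒≈ : ∀ {x y} → Small (λ m n → seq x n - seq y n) → x ≈ y
    small⇒≈ s = close λ ε ε>0 → let N , h = s ε ε>0 in N , λ n p → h n n p p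

    ≈⇒small : ∀ {x y} → x ≈ y → Small (λ m n → seq x n - seq y n)
    ≈⇒small (close e) ε ε>0 with e ε ε>0
    ... | N , h = N , λ m n p q → h n q

    small-0 : Small (λ m n → 0ℚ)
    small-0 ε ε>0 = 0 , λ m n p q → ε>0

    const-cauchy : ∀ q → Cauchy (λ _ → q)
    const-cauchy q = small-resp (λ m n → sym (ℚₚ.+-inverseʳ q)) small-0

    +-cauchy : ∀ x y → Cauchy (λ n → seq x n + seq y n)
    +-cauchy x y = small-resp
      (λ m n → sub-+
        (seq x m) (seq x n) (seq y m) (seq y n))
      (small-+ (cauchy x) (cauchy y))

    neg-cauchy : ∀ x → Cauchy (λ n → - seq x n)
    neg-cauchy x = small-resp
      (λ m n → neg-sub (seq x m) (seq x n))
      (small-neg (cauchy x))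

    *-cauchy : ∀ x y → Cauchy (λ n → seq x n * seq y n)
    *-cauchy x y = small-resp
      (λ m n → sub-*
        (seq x m) (seq x n) (seq y m) (seq y n))
      (small-+ (small-* (bounded₁ x) (cauchy y)) (small-* (bounded₂ y) (cauchy x)))

  fromℚ : ℚ → ℝ
  fromℚ q = real (λ _ → q) (const-cauchy q)

  infixl 6 _+ᵣ_
  infixl 7 _*ᵣ_

  _+ᵣ_ : ℝ → ℝ → ℝ
  x +ᵣ y = real (λ n → seq x n + seq y n) (+-cauchy x y)

  _*ᵣ_ : ℝ → ℝ → ℝ
  x *ᵣ y = real (λ n → seq x n * seq y n) (*-cauchy x y)

  -ᵣ_ : ℝ → ℝ
  -ᵣ x = real (λ n → - seq x n) (neg-cauchy x)

  private

    ≗⇒≈ : ∀ {x y} → (∀ n → seq x n ≡ seq y n) → x ≈ y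
    ≗⇒≈ {x} {y} e = small⇒≈
      (small-resp (λ m n → trans (sym (ℚₚ.+-inverseʳ (seq y n))) (cong (_- seq y n) (sym (e n)))) small-0)

    ≈-isEquivalence : IsEquivalence _≈_
    ≈-isEquivalence = record
      { refl  = λ {x} → ≗⇒≈ (λ _ → refl)
      ; sym   = λ {x} {y} e → small⇒≈ (small-resp
          (λ m n → neg-swap (seq x n) (seq y n))
          (small-neg (≈⇒small e)))
      ; trans = λ {x} {y} {z} e f → small⇒≈ (small-resp
          (λ m n → sub-telescope (seq x n) (seq y n) (seq z n))
          (small-+ (≈⇒small e) (≈⇒small f)))
      }

    +-cong : ∀ {x y u v} → x ≈ y → u ≈ v → x +ᵣ u ≈ y +ᵣ v
    +-cong {x} {y} {u} {v} e f = small⇒≈ (small-resp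
      (λ m n → sub-+
        (seq x n) (seq y n) (seq u n) (seq v n))
      (small-+ (≈⇒small e) (≈⇒small f)))

    neg-cong : ∀ {x y} → x ≈ y → -ᵣ x ≈ -ᵣ y
    neg-cong {x} {y} e = small⇒≈ (small-resp
      (λ m n → neg-sub (seq x n) (seq y n))
      (small-neg (≈⇒small e)))

    *-cong : ∀ {x y u v} → x ≈ y → u ≈ v → x *ᵣ u ≈ y *ᵣ v
    *-cong {x} {y} {u} {v} e f = small⇒≈ (small-resp
      (λ m n → sub-*
        (seq x n) (seq y n) (seq u n) (seq v n))
      (small-+ (small-* (bounded₂ x) (≈⇒small f)) (small-* (bounded₂ v) (≈⇒small e))))

    isCommutativeRing : IsCommutativeRing _≈_ _+ᵣ_ _*ᵣ_ -ᵣ_ (fromℚ 0ℚ) (fromℚ 1ℚ)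
    isCommutativeRing = record
      { isRing = record
        { +-isAbelianGroup = record
          { isGroup = record
            { isMonoid = record
              { isSemigroup = record
                { isMagma = record
                  { isEquivalence = ≈-isEquivalence
                  ; ∙-cong = +-cong }
                ; assoc = λ x y z → ≗⇒≈
                    (λ n → ℚₚ.+-assoc (seq x n) (seq y n) (seq z n)) }
              ; identity = (λ x → ≗⇒≈ (λ n → ℚₚ.+-identityˡ (seq x n)))
                         , (λ x → ≗⇒≈ (λ n → ℚₚ.+-identityʳ (seq x n))) }
            ; inverse = (λ x → ≗⇒≈ (λ n → ℚₚ.+-inverseˡ (seq x n)))
                      , (λ x → ≗⇒≈ (λ n → ℚₚ.+-inverseʳ (seq x n)))
            ; ⁻¹-cong = neg-cong }
          ; comm = λ x y → ≗⇒≈ (λ n → ℚₚ.+-comm (seq x n) (seq y n)) }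
        ; *-cong = *-cong
        ; *-assoc = λ x y z → ≗⇒≈
            (λ n → ℚₚ.*-assoc (seq x n) (seq y n) (seq z n))
        ; *-identity = (λ x → ≗⇒≈ (λ n → ℚₚ.*-identityˡ (seq x n)))
                     , (λ x → ≗⇒≈ (λ n → ℚₚ.*-identityʳ (seq x n)))
        ; distrib = (λ x y z → ≗⇒≈
                      (λ n → ℚₚ.*-distribˡ-+ (seq x n) (seq y n) (seq z n)))
                  , (λ x y z → ≗⇒≈
                      (λ n → ℚₚ.*-distribʳ-+ (seq x n) (seq y n) (seq z n))) }
      ; *-comm = λ x y → ≗⇒≈ (λ n → ℚₚ.*-comm (seq x n) (seq y n)) }

  commutativeRing : CommutativeRing 0ℓ 0ℓ
  commutativeRing = record { isCommutativeRing = isCommutativeRing }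

  ring : Ring 0ℓ 0ℓ
  ring = CommutativeRing.ring commutativeRing

-- In increasing order.
elements : ∀ {d} → Subset d → List (Fin d)
elements []            = []
elements (inside  ∷ B) = zero ∷ List.map suc (elements B)
elements (outside ∷ B) = List.map suc (elements B)

-- f(B), the sum of f over B.
weight : ∀ {d} → (Fin d → ℕ) → Subset d → ℕ
weight f B = sum (List.map f (elements B))

exchanged : ∀ {d} → Subset d → Fin d → Fin d → Subset d
exchanged B x y = (B Sub.- x) ∪ ⁅ y ⁆

module Weights where

  open Nat using (_+_; _≤_; _<_)

  weight-in : ∀ {d} (f : Fin (suc d) → ℕ) B → weight f (inside ∷ B) ≡ f zero + weight (f ∘ suc) B
  weight-in f B = cong (λ l → f zero + sum l) (sym (Listₚ.map-∘ (elements B)))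

  weight-out : ∀ {d} (f : Fin (suc d) → ℕ) B → weight f (outside ∷ B) ≡ weight (f ∘ suc) B
  weight-out f B = cong sum (sym (Listₚ.map-∘ (elements B)))

  +-left-comm : ∀ a b c → a + (b + c) ≡ b + (a + c)
  +-left-comm a b c = trans (sym (ℕₚ.+-assoc a b c))
    (trans (cong (_+ c) (ℕₚ.+-comm a b)) (ℕₚ.+-assoc b a c))

  weight-remove : ∀ {d} (f : Fin d → ℕ) {x} B → x ∈ B → weight f B ≡ f x + weight f (B Sub.- x)
  weight-remove f (inside ∷ B) here = trans (weight-in f B) (cong (f zero +_)
    (sym (trans (weight-out f (B ─ ⊥)) (cong (weight (f ∘ suc)) (Subₚ.p─⊥≡p B)))))
  weight-remove f {suc x} (inside ∷ B) (there x∈B) = trans (weight-in f B)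
    (trans (cong (f zero +_) (weight-remove (f ∘ suc) B x∈B))
      (trans (+-left-comm (f zero) (f (suc x)) (weight (f ∘ suc) (B Sub.- x)))
        (cong (f (suc x) +_) (sym (weight-in f (B Sub.- x))))))
  weight-remove f {suc x} (outside ∷ B) (there x∈B) = trans (weight-out f B)
    (trans (weight-remove (f ∘ suc) B x∈B) (cong (f (suc x) +_) (sym (weight-out f (B Sub.- x)))))

  weight-add : ∀ {d} (f : Fin d → ℕ) y B → y ∉ B → weight f (B ∪ ⁅ y ⁆) ≡ f y + weight f B
  weight-add f zero (inside ∷ B) y∉B = ⊥-elim (y∉B here)
  weight-add f zero (outside ∷ B) y∉B
    rewrite weight-in f (B ∪ ⊥) | Subₚ.∪-identityʳ B | weight-out f B = refl
  weight-add f (suc y) (inside ∷ B) y∉B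
    rewrite weight-in f (B ∪ ⁅ y ⁆) | weight-in f B | weight-add (f ∘ suc) y B (y∉B ∘ there)
    = +-left-comm (f zero) (f (suc y)) (weight (f ∘ suc) B)
  weight-add f (suc y) (outside ∷ B) y∉B
    rewrite weight-out f (B ∪ ⁅ y ⁆) | weight-out f B = weight-add (f ∘ suc) y B (y∉B ∘ there)

  weight-exchange : ∀ {d} (f : Fin d → ℕ) {x y} B → x ∈ B → y ∉ B →
                    weight f (exchanged B x y) + f x ≡ weight f B + f y
  weight-exchange f {x} {y} B x∈B y∉B
    rewrite weight-add f y (B Sub.- x) (λ y∈ → y∉B (Subₚ.p─q⊆p B ⁅ x ⁆ y∈)) | weight-remove f B x∈B
    = trans (ℕₚ.+-assoc (f y) w (f x)) (trans (ℕₚ.+-comm (f y) (w + f x))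
        (cong (_+ f y) (ℕₚ.+-comm w (f x))))
    where
    w = weight f (B Sub.- x)

  weight-mono : ∀ {d} (f : Fin d → ℕ) P Q → (∀ z → z ∈ P → z ∈ Q ⊎ f z ≡ 0) → weight f P ≤ weight f Q
  weight-mono f [] [] h = z≤n
  weight-mono f (s ∷ P) (t ∷ Q) h = go s t h
    where
    ih : ∀ {s t} → (∀ z → z ∈ s ∷ P → z ∈ t ∷ Q ⊎ f z ≡ 0) → weight (f ∘ suc) P ≤ weight (f ∘ suc) Q
    ih h = weight-mono (f ∘ suc) P Q λ z z∈P → lower (h (suc z) (there z∈P))
      where
      lower : ∀ {z t} → suc z ∈ t ∷ Q ⊎ f (suc z) ≡ 0 → z ∈ Q ⊎ f (suc z) ≡ 0
      lower (inj₁ (there z∈Q)) = inj₁ z∈Q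
      lower (inj₂ e)           = inj₂ e
    go : ∀ s t → (∀ z → z ∈ s ∷ P → z ∈ t ∷ Q ⊎ f z ≡ 0) → weight f (s ∷ P) ≤ weight f (t ∷ Q)
    go inside inside h rewrite weight-in f P | weight-in f Q = ℕₚ.+-monoʳ-≤ (f zero) (ih h)
    go inside outside h rewrite weight-in f P | weight-out f Q with h zero here
    ... | inj₂ e rewrite e = ih h
    go outside inside h rewrite weight-out f P | weight-in f Q = ℕₚ.m≤n⇒m≤o+n (f zero) (ih h)
    go outside outside h rewrite weight-out f P | weight-out f Q = ih h

  weight-mono-extra : ∀ {d} (f : Fin d → ℕ) P Q {x} → x ∈ Q → x ∉ P →
                      (∀ z → z ∈ P → z ∈ Q ⊎ f z ≡ 0) → f x + weight f P ≤ weight f Q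
  weight-mono-extra f P Q {x} x∈Q x∉P h rewrite sym (weight-add f x P x∉P) =
    weight-mono f (P ∪ ⁅ x ⁆) Q λ z z∈ → case-∪ z (Subₚ.x∈p∪q⁻ P ⁅ x ⁆ z∈)
    where
    case-∪ : ∀ z → z ∈ P ⊎ z ∈ ⁅ x ⁆ → z ∈ Q ⊎ f z ≡ 0
    case-∪ z (inj₁ z∈P) = h z z∈P
    case-∪ z (inj₂ z∈x) rewrite Subₚ.x∈⁅y⁆⇒x≡y x z∈x = inj₁ x∈Q

  x∉exchanged : ∀ {d} B {x y : Fin d} → y ∉ B → x ∈ B → x ∉ exchanged B x y
  x∉exchanged B {x} {y} y∉B x∈B x∈ with Subₚ.x∈p∪q⁻ (B Sub.- x) ⁅ y ⁆ x∈
  ... | inj₁ p = ∉-removed B p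
    where
    ∉-removed : ∀ {d} B {x : Fin d} → x ∉ B Sub.- x
    ∉-removed (s ∷ B) {zero} ()
    ∉-removed (s ∷ B) {suc x} (there p) = ∉-removed B p
  ... | inj₂ q rewrite Subₚ.x∈⁅y⁆⇒x≡y y q = y∉B x∈B

  y∈exchanged : ∀ {d} B (x y : Fin d) → y ∈ exchanged B x y
  y∈exchanged B x y = Subₚ.x∈p∪q⁺ {p = B Sub.- x} (inj₂ (Subₚ.x∈⁅x⁆ y))

  argmin : ∀ {d} (f : Fin d → ℕ) {P : Fin d → Set} → Decidable P → ∃ P →
           ∃ λ m → P m × ∀ z → P z → f m ≤ f z
  argmin {suc d} f {P} P? (w , Pw) with Finₚ.any? (P? ∘ suc)
  ... | no ∄ = only w Pw
    where
    only : ∀ w → P w → ∃ λ m → P m × ∀ z → P z → f m ≤ f z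
    only zero Pw = zero , Pw , λ where
      zero    _  → ℕₚ.≤-refl
      (suc z) Pz → ⊥-elim (∄ (z , Pz))
    only (suc w) Pw = ⊥-elim (∄ (w , Pw))
  ... | yes ∃P with argmin (f ∘ suc) (P? ∘ suc) ∃P
  ... | m , Pm , mmin with P? zero
  ... | no ¬P0 = suc m , Pm , λ where
    zero    P0 → ⊥-elim (¬P0 P0)
    (suc z) Pz → mmin z Pz
  ... | yes P0 with ℕₚ.≤-total (f zero) (f (suc m))
  ... | inj₁ 0≤m = zero , P0 , λ where
    zero    _  → ℕₚ.≤-refl
    (suc z) Pz → ℕₚ.≤-trans 0≤m (mmin z Pz)
  ... | inj₂ m≤0 = suc m , Pm , λ where
    zero    _  → m≤0
    (suc z) Pz → mmin z Pz

-- Matroids on [d], with Fin d standing for [d], given by their bases.  The Boolean test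
-- carries no restriction, as the power set of [d] is finite.
record Matroid (d : ℕ) : Set where
  field
    isBasis : Subset d → Bool

  Basis : Subset d → Set
  Basis B = T (isBasis B)

  field
    nonempty : ∃ Basis
    exchange : ∀ {B B′ x} → Basis B → Basis B′ → x ∈ B → x ∉ B′ →
               ∃ λ y → y ∈ B′ × y ∉ B × Basis (exchanged B x y)

open Matroid using (isBasis; Basis; nonempty; exchange)

matroidSetoid : ℕ → Setoid 0ℓ 0ℓ
matroidSetoid d = record
  { Carrier       = Matroid d
  ; _≈_           = λ M N → ∀ B → isBasis M B ≡ isBasis N B
  ; isEquivalence = record
    { refl  = λ B → refl
    ; sym   = λ e B → sym (e B)
    ; trans = λ e f B → trans (e B) (f B)
    }
  }

-- b₁ ≤ a₁, …, bᵣ ≤ aᵣ; in particular B and A have the same number r of elements.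
infix 4 _≤ᴳ_
_≤ᴳ_ : ∀ {d} → Subset d → Subset d → Set
B ≤ᴳ A = Pointwise Fin._≤_ (elements B) (elements A)

_≤ᴳ?_ : ∀ {d} (B A : Subset d) → Dec (B ≤ᴳ A)
B ≤ᴳ? A = Pointwise.decidable Finₚ._≤?_ (elements B) (elements A)

module Gale where

  open Nat using (_+_; _≤_; _<_)
  open Weights

  -- the indicator function of {i : i ≤ t}
  χ : ∀ {d} → Fin d → Fin d → ℕ
  χ t i = if does (i Finₚ.≤? t) then 1 else 0

  χ-yes : ∀ {d} {t i : Fin d} → i Fin.≤ t → χ t i ≡ 1
  χ-yes {t = t} {i} p = cong (λ b → if b then 1 else 0) (dec-true (i Finₚ.≤? t) p)

  χ-no : ∀ {d} {t i : Fin d} → ¬ i Fin.≤ t → χ t i ≡ 0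
  χ-no {t = t} {i} ¬p = cong (λ b → if b then 1 else 0) (dec-false (i Finₚ.≤? t) ¬p)

  χ≤1 : ∀ {d} (t i : Fin d) → χ t i ≤ 1
  χ≤1 t i with i Finₚ.≤? t
  ... | yes p = ℕₚ.≤-reflexive (χ-yes p)
  ... | no ¬p = ℕₚ.≤-trans (ℕₚ.≤-reflexive (χ-no ¬p)) z≤n

  χ-anti : ∀ {d} (t : Fin d) {i j} → i Fin.≤ j → χ t j ≤ χ t i
  χ-anti t {i} {j} i≤j with j Finₚ.≤? t
  ... | no j≰t  = ℕₚ.≤-trans (ℕₚ.≤-reflexive (χ-no j≰t)) z≤n
  ... | yes j≤t = ℕₚ.≤-trans (χ≤1 t j) (ℕₚ.≤-reflexive (sym (χ-yes (ℕₚ.≤-trans i≤j j≤t))))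

  Sorted : ∀ {d} → List (Fin d) → Set
  Sorted = AllPairs Fin._<_

  shift : ∀ {d} {l : List (Fin d)} → Sorted l → AllPairs (λ i j → suc i Fin.< suc j) l
  shift []       = []
  shift (a ∷ as) = All.map s≤s a ∷ shift as

  elements-sorted : ∀ {d} (B : Subset d) → Sorted (elements B)
  elements-sorted []            = []
  elements-sorted (inside  ∷ B) =
    Allₚ.map⁺ (All.tabulate λ _ → s≤s z≤n) ∷ AllPairsₚ.map⁺ (shift (elements-sorted B))
  elements-sorted (outside ∷ B) = AllPairsₚ.map⁺ (shift (elements-sorted B))

  count : ∀ {d} → (Fin d → ℕ) → List (Fin d) → ℕ
  count f l = sum (List.map f l)

  count-zero : ∀ {d} (t : Fin d) l → All (t Fin.<_) l → count (χ t) l ≡ 0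
  count-zero t []      []       = refl
  count-zero t (y ∷ l) (a ∷ as) rewrite χ-no (ℕₚ.<⇒≱ a) = count-zero t l as

  ≤⇒count : ∀ {d} (t : Fin d) {xs ys} → Pointwise Fin._≤_ xs ys → count (χ t) ys ≤ count (χ t) xs
  ≤⇒count t []       = z≤n
  ≤⇒count t (p ∷ ps) = ℕₚ.+-mono-≤ (χ-anti t p) (≤⇒count t ps)

  ≤⇒size : ∀ {d} {xs ys : List (Fin d)} → Pointwise Fin._≤_ xs ys → count (λ _ → 1) xs ≡ count (λ _ → 1) ys
  ≤⇒size []       = refl
  ≤⇒size (p ∷ ps) = cong suc (≤⇒size ps)

  count⇒≤ : ∀ {d} (xs ys : List (Fin d)) → Sorted xs → Sorted ys →
            count (λ _ → 1) xs ≡ count (λ _ → 1) ys →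
            (∀ t → count (χ t) ys ≤ count (χ t) xs) → Pointwise Fin._≤_ xs ys
  count⇒≤ []       []       sx sy e h = []
  count⇒≤ (x ∷ xs) (y ∷ ys) (ax ∷ sx) (ay ∷ sy) e h = x≤y ∷ count⇒≤ xs ys sx sy (ℕₚ.suc-injective e) tails
    where
    x≤y : x Fin.≤ y
    x≤y with x Finₚ.≤? y | h y
    ... | yes p | _ = p
    ... | no ¬p | q rewrite χ-no ¬p | χ-yes (ℕₚ.≤-refl {toℕ y})
                          | count-zero y xs (All.map (ℕₚ.<-trans (ℕₚ.≰⇒> ¬p)) ax) with q
    ... | ()
    tails : ∀ t → count (χ t) ys ≤ count (χ t) xs
    tails t with y Finₚ.≤? t | h t
    ... | no ¬p | _ rewrite count-zero t ys (All.map (ℕₚ.<-trans (ℕₚ.≰⇒> ¬p)) ay) = z≤n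
    ... | yes p | q rewrite χ-yes (ℕₚ.≤-trans x≤y p) | χ-yes p = ℕₚ.≤-pred q

  ≤ᴳ-refl : ∀ {d} (A : Subset d) → A ≤ᴳ A
  ≤ᴳ-refl A = Pointwise.refl (ℕₚ.≤-refl)

  ≤ᴳ-exchange : ∀ {d} {A B B′ : Subset d} {x} → B ≤ᴳ A → B′ ≤ᴳ A → x ∈ B → x ∉ B′ →
                ∃ λ y → y ∈ B′ × y ∉ B × exchanged B x y ≤ᴳ A
  ≤ᴳ-exchange {A = A} {B} {B′} {x} B≤A B′≤A x∈B x∉B′ = y , y∈B′ , y∉B ,
    count⇒≤ (elements C) (elements A) (elements-sorted C) (elements-sorted A) sizes counts
    where
    Cand : Fin _ → Set
    Cand z = z ∈ B′ × z ∉ B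

    cand? : Decidable Cand
    cand? z = (z Subₚ.∈? B′) ×-dec ¬? (z Subₚ.∈? B)

    ∈-or-no : (∄ : ¬ ∃ Cand) → ∀ z → z ∈ B′ → z ∈ B ⊎ 1 ≡ 0
    ∈-or-no ∄ z z∈B′ with z Subₚ.∈? B
    ... | yes z∈B = inj₁ z∈B
    ... | no z∉B  = ⊥-elim (∄ (z , z∈B′ , z∉B))

    some : ∃ Cand
    some with Finₚ.any? cand?
    ... | yes c = c
    ... | no ∄  = ⊥-elim (ℕₚ.<-irrefl
      (trans (≤⇒size B′≤A) (sym (≤⇒size B≤A)))
      (weight-mono-extra (λ _ → 1) B′ B x∈B x∉B′ (∈-or-no ∄)))

    least = argmin toℕ cand? some
    y     = proj₁ least
    y∈B′  = proj₁ (proj₁ (proj₂ least))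
    y∉B   = proj₂ (proj₁ (proj₂ least))
    C     = exchanged B x y

    y-least : ∀ z → z ∈ B′ → z ∉ B → y Fin.≤ z
    y-least z z∈B′ z∉B = proj₂ (proj₂ least) z (z∈B′ , z∉B)

    sizes : weight (λ _ → 1) C ≡ weight (λ _ → 1) A
    sizes = trans (ℕₚ.+-cancelʳ-≡ 1 _ _ (weight-exchange (λ _ → 1) B x∈B y∉B)) (≤⇒size B≤A)

    counts : ∀ t → weight (χ t) A ≤ weight (χ t) C
    counts t with y Finₚ.≤? t | x Finₚ.≤? t | weight-exchange (χ t) B x∈B y∉B
    ... | yes y≤t | _ | e rewrite χ-yes y≤t =
      ℕₚ.≤-trans (≤⇒count t B≤A) (ℕₚ.+-cancelʳ-≤ 1 _ _ (ℕₚ.≤-trans (ℕₚ.≤-reflexive (sym e))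
        (ℕₚ.+-monoʳ-≤ (weight (χ t) C) (χ≤1 t x))))
    ... | no y≰t | no x≰t | e rewrite χ-no y≰t | χ-no x≰t =
      ℕₚ.≤-trans (≤⇒count t B≤A) (ℕₚ.≤-reflexive (sym (ℕₚ.+-cancelʳ-≡ 0 _ _ e)))
    ... | no y≰t | yes x≤t | e rewrite χ-no y≰t | χ-yes x≤t =
      ℕₚ.≤-trans (≤⇒count t B′≤A) (ℕₚ.+-cancelˡ-≤ 1 _ _ (ℕₚ.≤-trans more
        (ℕₚ.≤-reflexive (trans (sym (ℕₚ.+-identityʳ _)) (trans (sym e) (ℕₚ.+-comm _ 1))))))
      where
      inside-or-late : ∀ z → z ∈ B′ → z ∈ B ⊎ χ t z ≡ 0
      inside-or-late z z∈B′ with z Subₚ.∈? B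
      ... | yes z∈B = inj₁ z∈B
      ... | no z∉B  = inj₂ (χ-no λ z≤t → y≰t (ℕₚ.≤-trans (y-least z z∈B′ z∉B) z≤t))
      more : 1 + weight (χ t) B′ ≤ weight (χ t) B
      more = subst (λ k → k + weight (χ t) B′ ≤ weight (χ t) B) (χ-yes x≤t)
        (weight-mono-extra (χ t) B′ B x∈B x∉B′ inside-or-late)

SM : ∀ {d} → Subset d → Matroid d
SM A = record
  { isBasis  = λ B → ⌊ B ≤ᴳ? A ⌋
  ; nonempty = A , fromWitness {a? = A ≤ᴳ? A} (Gale.≤ᴳ-refl A)
  ; exchange = λ {B} {B′} {x} b b′ x∈B x∉B′ →
      let y , y∈B′ , y∉B , c = Gale.≤ᴳ-exchange {A = A} {B} {B′} (toWitness {a? = B ≤ᴳ? A} b) (toWitness {a? = B′ ≤ᴳ? A} b′) x∈B x∉B′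
      in y , y∈B′ , y∉B , fromWitness {a? = exchanged B x y ≤ᴳ? A} c
  }

-- Real-valued f are not needed: only integer-valued ones index words.
Maximizes : ∀ {d} → Matroid d → (Fin d → ℕ) → Subset d → Set
Maximizes M f B = Basis M B × (∀ B′ → Basis M B′ → weight f B′ Nat.≤ weight f B)

Generic : ∀ {d} → Matroid d → (Fin d → ℕ) → Set
Generic M f = ∃! _≡_ (Maximizes M f)

∀Subset? : ∀ {d} {P : Subset d → Set} → Decidable P → Dec (∀ B → P B)
∀Subset? P? = map′
  (λ ∄ B → decidable-stable (P? B) λ ¬PB → ∄ (B , ¬PB))
  (λ all (B , ¬PB) → ¬PB (all B))
  (¬? (Subₚ.anySubset? (λ B → ¬? (P? B))))

maximizes? : ∀ {d} (M : Matroid d) f → Decidable (Maximizes M f)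
maximizes? M f B = T? (isBasis M B) ×-dec
  ∀Subset? (λ B′ → T? (isBasis M B′) →-dec (weight f B′ ℕₚ.≤? weight f B))

generic? : ∀ {d} (M : Matroid d) f → Dec (Generic M f)
generic? M f = Subₚ.anySubset? λ B → maximizes? M f B ×-dec
  map′ (λ h {B′} → h B′) (λ h B′ → h {B′})
    (∀Subset? (λ B′ → maximizes? M f B′ →-dec Vecₚ.≡-dec Boolₚ._≟_ B B′))

levelSet : ∀ {d} → (Fin d → ℕ) → ℕ → Subset d
levelSet f v = Vec.tabulate λ i → does (f i ℕₚ.≟ v)

-- The nonempty level sets, by increasing value.
setCompositionType : ∀ {d} → (Fin d → ℕ) → List (Subset d)
setCompositionType f =
  filter Subₚ.nonempty? (List.map (levelSet f) (upTo (suc (max 0 (List.tabulate f)))))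

-- Whether f is M-generic depends only on the set composition type of f.  The sums f(B) are
-- not determined by the type, so this uses basis exchange.
module TypeInvariance where

  open Nat using (_+_; _≤_; _<_)
  open Weights

  position : ∀ {d} → Fin d → List (Subset d) → ℕ
  position i []      = 0
  position i (B ∷ L) = if does (i Subₚ.∈? B) then 0 else suc (position i L)

  ∈levelSet⁺ : ∀ {d} (f : Fin d → ℕ) {i v} → f i ≡ v → i ∈ levelSet f v
  ∈levelSet⁺ f {i} {v} e = Vecₚ.lookup⇒[]= i _
    (trans (Vecₚ.lookup∘tabulate _ i) (dec-true (f i ℕₚ.≟ v) e))

  ∈levelSet⁻ : ∀ {d} (f : Fin d → ℕ) {i v} → i ∈ levelSet f v → f i ≡ v
  ∈levelSet⁻ f {i} {v} i∈ = decidable-stable (f i ℕₚ.≟ v) λ ¬e →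
    false≢true (trans (sym (dec-false (f i ℕₚ.≟ v) ¬e))
      (trans (sym (Vecₚ.lookup∘tabulate _ i)) (Vecₚ.[]=⇒lookup i∈)))
    where
    false≢true : false ≢ true
    false≢true ()

  blocks : ∀ {d} → (Fin d → ℕ) → List ℕ → List (Subset d)
  blocks f vs = filter Subₚ.nonempty? (List.map (levelSet f) vs)

  position-cong : ∀ {d} (f : Fin d → ℕ) {i j} vs → f i ≡ f j → position i (blocks f vs) ≡ position j (blocks f vs)
  position-cong f         []       e = refl
  position-cong f {i} {j} (v ∷ vs) e with Subₚ.nonempty? (levelSet f v)
  ... | no _  = position-cong f vs e
  ... | yes _ with i Subₚ.∈? levelSet f v | j Subₚ.∈? levelSet f v
  ... | yes p | yes q = refl
  ... | yes p | no ¬q = ⊥-elim (¬q (∈levelSet⁺ f (trans (sym e) (∈levelSet⁻ f p))))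
  ... | no ¬p | yes q = ⊥-elim (¬p (∈levelSet⁺ f (trans e (∈levelSet⁻ f q))))
  ... | no ¬p | no ¬q = cong suc (position-cong f vs e)

  position-mono : ∀ {d} (f : Fin d → ℕ) {i j} vs → AllPairs _<_ vs → f i ∈ₗ vs → f j ∈ₗ vs → f i < f j →
                  position i (blocks f vs) < position j (blocks f vs)
  position-mono f {i} {j} (v ∷ vs) (av ∷ sv) (here e) j∈ lt with Subₚ.nonempty? (levelSet f v)
  ... | no ∅ = ⊥-elim (∅ (i , ∈levelSet⁺ f e))
  ... | yes _ with i Subₚ.∈? levelSet f v | j Subₚ.∈? levelSet f v
  ... | no ¬p | _     = ⊥-elim (¬p (∈levelSet⁺ f e))
  ... | yes p | yes q = ⊥-elim (ℕₚ.<-irrefl (trans e (sym (∈levelSet⁻ f q))) lt)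
  ... | yes p | no ¬q = s≤s z≤n
  position-mono f (v ∷ vs) (av ∷ sv) (there i∈) (here e) lt =
    ⊥-elim (ℕₚ.<-asym lt (subst (_< _) (sym e) (All.lookup av i∈)))
  position-mono f {i} {j} (v ∷ vs) (av ∷ sv) (there i∈) (there j∈) lt with Subₚ.nonempty? (levelSet f v)
  ... | no _ = position-mono f vs sv i∈ j∈ lt
  ... | yes _ with i Subₚ.∈? levelSet f v | j Subₚ.∈? levelSet f v
  ... | yes p | _     = ⊥-elim (ℕₚ.<-irrefl (sym (∈levelSet⁻ f p)) (All.lookup av i∈))
  ... | no _  | yes q = ⊥-elim (ℕₚ.<-irrefl (sym (∈levelSet⁻ f q)) (All.lookup av j∈))
  ... | no _  | no _  = s≤s (position-mono f vs sv i∈ j∈ lt)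

  range : ∀ {d} → (Fin d → ℕ) → List ℕ
  range f = upTo (suc (max 0 (List.tabulate f)))

  ∈range : ∀ {d} (f : Fin d → ℕ) i → f i ∈ₗ range f
  ∈range f i = ∈-upTo⁺ (s≤s (Allₚ.tabulate⁻ (xs≤max 0 (List.tabulate f)) i))

  range-sorted : ∀ {d} (f : Fin d → ℕ) → AllPairs _<_ (range f)
  range-sorted f = AllPairsₚ.applyUpTo⁺₁ _ _ (λ i<j _ → i<j)

  type⇒order : ∀ {d} (f g : Fin d → ℕ) → setCompositionType f ≡ setCompositionType g →
               ∀ {i j} → f i ≤ f j → g i ≤ g j
  type⇒order f g e {i} {j} fi≤fj with g i ℕₚ.≤? g j
  ... | yes p = p
  ... | no ¬p = ⊥-elim (ℕₚ.<⇒≱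
    (subst (λ L → position j L < position i L) (sym e)
      (position-mono g (range g) (range-sorted g) (∈range g j) (∈range g i) (ℕₚ.≰⇒> ¬p)))
    weakly)
    where
    weakly : position i (setCompositionType f) ≤ position j (setCompositionType f)
    weakly with ℕₚ.m≤n⇒m<n∨m≡n fi≤fj
    ... | inj₁ lt = ℕₚ.<⇒≤ (position-mono f (range f) (range-sorted f) (∈range f i) (∈range f j) lt)
    ... | inj₂ eq = ℕₚ.≤-reflexive (position-cong f (range f) eq)

  generic-resp-order : ∀ {d} (M : Matroid d) (f g : Fin d → ℕ) →
    (∀ {i j} → f i ≤ f j → g i ≤ g j) → (∀ {i j} → g i ≤ g j → f i ≤ f j) →
    Generic M f → Generic M g
  generic-resp-order {d} M f g f⇒g g⇒f (B , (basisB , maxB) , uniqueB) =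
    B , (basisB , λ B′ b′ → weakly B′ b′) , λ {B′} → unique B′
    where
    strict-f : ∀ C → Basis M C → B ≢ C → weight f C < weight f B
    strict-f C c B≢C = ℕₚ.≤∧≢⇒< (maxB C c) λ e →
      B≢C (uniqueB (c , λ B′ b′ → ℕₚ.≤-trans (maxB B′ b′) (ℕₚ.≤-reflexive (sym e))))

    f⇒g-< : ∀ {i j} → f i < f j → g i < g j
    f⇒g-< lt = ℕₚ.≰⇒> λ ge → ℕₚ.<⇒≱ lt (g⇒f ge)

    trade-≤ : ∀ {w w′ a b} → w + a ≡ w′ + b → a ≤ b → w′ ≤ w
    trade-≤ {w} {w′} {a} {b} e a≤b = ℕₚ.+-cancelʳ-≤ b w′ w
      (ℕₚ.≤-trans (ℕₚ.≤-reflexive (sym e)) (ℕₚ.+-monoʳ-≤ w a≤b))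

    trade-< : ∀ {w w′ a b} → w + a ≡ w′ + b → a < b → w′ < w
    trade-< {w} {w′} {a} {b} e a<b = ℕₚ.+-cancelʳ-< b w′ w
      (ℕₚ.≤-<-trans (ℕₚ.≤-reflexive (sym e)) (ℕₚ.+-monoʳ-< w a<b))

    trade-<⁻ : ∀ {w w′ a b} → w + a ≡ w′ + b → w′ < w → a < b
    trade-<⁻ {w} {w′} {a} {b} e lt = ℕₚ.+-cancelˡ-< w a b
      (ℕₚ.≤-<-trans (ℕₚ.≤-reflexive e) (ℕₚ.+-monoˡ-< b lt))

    Differs : Subset d → Fin d → Set
    Differs C z = (z ∈ C × z ∉ B) ⊎ (z ∈ B × z ∉ C)

    differs? : ∀ C → Decidable (Differs C)
    differs? C z = ((z Subₚ.∈? C) ×-dec ¬? (z Subₚ.∈? B)) ⊎-dec ((z Subₚ.∈? B) ×-dec ¬? (z Subₚ.∈? C))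

    differ : ∀ C → B ≢ C → ∃ (Differs C)
    differ C B≢C with Finₚ.any? (differs? C)
    ... | yes w = w
    ... | no ∄  = ⊥-elim (B≢C (Subₚ.⊆-antisym
      (λ {z} z∈B → decidable-stable (z Subₚ.∈? C) λ z∉C → ∄ (z , inj₂ (z∈B , z∉C)))
      (λ {z} z∈C → decidable-stable (z Subₚ.∈? B) λ z∉B → ∄ (z , inj₁ (z∈C , z∉B)))))

    strict-g : ∀ C → Acc _<_ Sub.∣ C ─ B ∣ → Basis M C → B ≢ C → weight g C < weight g B
    strict-g C (acc rec) c B≢C with argmin f (differs? C) (differ C B≢C)
    ... | y , inj₂ (y∈B , y∉C) , y-least with exchange M basisB c y∈B y∉C
    ... | x , x∈C , x∉B , d′ = ⊥-elim (ℕₚ.<⇒≱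
      (strict-f D d′ λ e → x∉B (subst (x ∈_) (sym e) (y∈exchanged B y x)))
      (trade-≤ (weight-exchange f B y∈B x∉B) (y-least x (inj₁ (x∈C , x∉B)))))
      where
      D = exchanged B y x
    strict-g C (acc rec) c B≢C | x , inj₁ (x∈C , x∉B) , x-least with exchange M c basisB x∈C x∉B
    ... | y , y∈B , y∉C , d′ with Vecₚ.≡-dec Boolₚ._≟_ B (exchanged C x y)
    ... | yes e = subst (λ D → weight g C < weight g D) (sym e)
      (trade-< (weight-exchange g C x∈C y∉C)
        (f⇒g-< (trade-<⁻ (weight-exchange f C x∈C y∉C)
          (subst (λ D → weight f C < weight f D) e (strict-f C c B≢C)))))
    ... | no B≢D = ℕₚ.≤-<-trans
      (trade-≤ (weight-exchange g C x∈C y∉C) (f⇒g (x-least y (inj₂ (y∈B , y∉C)))))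
      (strict-g D (rec closer) d′ B≢D)
      where
      D = exchanged C x y
      shrink : ∀ {z} → z ∈ D ─ B → z ∈ C ─ B
      shrink {z} z∈ = Subₚ.x∈p∧x∉q⇒x∈p─q z∈C z∉B
        where
        ∉-diff : ∀ {n} (P Q : Subset n) {z} → z ∈ P ─ Q → z ∉ Q
        ∉-diff (s ∷ P) (inside  ∷ Q) {zero}  ()
        ∉-diff (s ∷ P) (outside ∷ Q) {zero}  _         ()
        ∉-diff (s ∷ P) (t ∷ Q)       {suc z} (there p) (there q) = ∉-diff P Q p q
        z∉B : z ∉ B
        z∉B = ∉-diff D B z∈
        z∈C : z ∈ C
        z∈C with Subₚ.x∈p∪q⁻ (C Sub.- x) ⁅ y ⁆ (Subₚ.p─q⊆p D B z∈)
        ... | inj₁ p = Subₚ.p─q⊆p C ⁅ x ⁆ p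
        ... | inj₂ q = ⊥-elim (z∉B (subst (_∈ B) (sym (Subₚ.x∈⁅y⁆⇒x≡y y q)) y∈B))
      closer : Sub.∣ D ─ B ∣ < Sub.∣ C ─ B ∣
      closer = Subₚ.p⊂q⇒∣p∣<∣q∣ (shrink , x , Subₚ.x∈p∧x∉q⇒x∈p─q x∈C x∉B ,
        λ x∈ → x∉exchanged C y∉C x∈C (Subₚ.p─q⊆p D B x∈))

    strict : ∀ C → Basis M C → B ≢ C → weight g C < weight g B
    strict C = strict-g C (<-wellFounded _)

    weakly : ∀ C → Basis M C → weight g C ≤ weight g B
    weakly C c with Vecₚ.≡-dec Boolₚ._≟_ B C
    ... | yes refl = ℕₚ.≤-refl
    ... | no B≢C   = ℕₚ.<⇒≤ (strict C c B≢C)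

    unique : ∀ C → Maximizes M g C → B ≡ C
    unique C (c , maxC) with Vecₚ.≡-dec Boolₚ._≟_ B C
    ... | yes e  = e
    ... | no B≢C = ⊥-elim (ℕₚ.<⇒≱ (strict C c B≢C) (maxC B basisB))

  generic-resp-type : ∀ {d} (M : Matroid d) (f g : Fin d → ℕ) →
    setCompositionType f ≡ setCompositionType g → does (generic? M f) ≡ does (generic? M g)
  generic-resp-type M f g e = does-⇔
    (mk⇔ (generic-resp-order M f g (type⇒order f g e) (type⇒order g f (sym e)))
         (generic-resp-order M g f (type⇒order g f (sym e)) (type⇒order f g e)))
    (generic? M f) (generic? M g)

  generic-resp-matroid : ∀ {d} (M N : Matroid d) (f : Fin d → ℕ) →
    (∀ B → isBasis M B ≡ isBasis N B) → does (generic? M f) ≡ does (generic? N f)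
  generic-resp-matroid M N f e = does-⇔ (mk⇔ (transport M N e) (transport N M (λ B → sym (e B))))
    (generic? M f) (generic? N f)
    where
    max-resp : ∀ M N → (∀ B → isBasis M B ≡ isBasis N B) → ∀ {B} → Maximizes M f B → Maximizes N f B
    max-resp M N e {B} (b , m) = subst T (e B) b , λ B′ b′ → m B′ (subst T (sym (e B′)) b′)
    transport : ∀ M N → (∀ B → isBasis M B ≡ isBasis N B) → Generic M f → Generic N f
    transport M N e (B , m , u) = B , max-resp M N e m , λ m′ → u (max-resp N M (λ B → sym (e B)) m′)

module LinearAlgebra {r ℓr : Level} (R : Ring r ℓr) where

  open Ring R using (Carrier; 0#; 1#; _+_; _*_) renaming (_≈_ to _≈ᴿ_)

  -- Linear combinations range over finitely many distinct indices.
  LinearlyIndependent : ∀ {m ℓm i} (V : LeftModule R m ℓm) {I : Set i} →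
                        (I → LeftModule.Carrierᴹ V) → Set (r ⊔ ℓr ⊔ ℓm ⊔ i)
  LinearlyIndependent V {I} v =
    ∀ {n} (ι : Fin n → I) → Injective _≡_ _≡_ ι →
    (c : Fin n → Carrier) → ∑ (λ k → c k *ₗ v (ι k)) ≈ᴹ 0ᴹ →
    ∀ k → c k ≈ᴿ 0#
    where
    open LeftModule V
    open MonoidSum +ᴹ-commutativeMonoid using () renaming (sum to ∑)

  record LinearMap {m ℓm n ℓn : Level} (V : LeftModule R m ℓm) (W : LeftModule R n ℓn)
                   : Set (r ⊔ m ⊔ ℓm ⊔ n ⊔ ℓn) where
    field
      apply          : LeftModule.Carrierᴹ V → LeftModule.Carrierᴹ W
      isHomomorphism : IsLeftModuleHomomorphism (LeftModule.rawLeftModule V) (LeftModule.rawLeftModule W) apply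

  open LinearMap public

  -- The image of φ has dimension at least n: it contains n linearly independent vectors.
  RankAtLeast : ∀ {m ℓm k ℓk} {V : LeftModule R m ℓm} {W : LeftModule R k ℓk} →
                LinearMap V W → ℕ → Set (r ⊔ ℓr ⊔ m ⊔ ℓk)
  RankAtLeast {V = V} {W} φ n =
    ∃ λ (v : Fin n → LeftModule.Carrierᴹ V) → LinearlyIndependent W (apply φ ∘ v)

  -- The free module on a setoid, presented by generators and relations: _≋_ is the least
  -- congruence satisfying the module axioms and identifying equal generators.
  module Free {s ℓs : Level} (S : Setoid s ℓs) where

    private module S = Setoid S

    infixl 6 _⊕_
    infixr 7 _⊙_
    infix  4 _≋_

    data Term : Set (r ⊔ s) where
      [_]  : S.Carrier → Term
      𝟘    : Term
      _⊕_  : Term → Term → Term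
      ⊖_   : Term → Term
      _⊙_  : Carrier → Term → Term

    data _≋_ : Term → Term → Set (r ⊔ ℓr ⊔ s ⊔ ℓs) where
      ≋-refl      : ∀ {t} → t ≋ t
      ≋-sym       : ∀ {t u} → t ≋ u → u ≋ t
      ≋-trans     : ∀ {t u v} → t ≋ u → u ≋ v → t ≋ v
      []-cong     : ∀ {x y} → x S.≈ y → [ x ] ≋ [ y ]
      ⊕-cong      : ∀ {t t′ u u′} → t ≋ t′ → u ≋ u′ → t ⊕ u ≋ t′ ⊕ u′
      ⊖-cong      : ∀ {t u} → t ≋ u → ⊖ t ≋ ⊖ u
      ⊙-cong      : ∀ {a b t u} → a ≈ᴿ b → t ≋ u → a ⊙ t ≋ b ⊙ u
      ⊕-assoc     : ∀ t u v → (t ⊕ u) ⊕ v ≋ t ⊕ (u ⊕ v)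
      ⊕-comm      : ∀ t u → t ⊕ u ≋ u ⊕ t
      ⊕-identityˡ : ∀ t → 𝟘 ⊕ t ≋ t
      ⊖-inverseˡ  : ∀ t → (⊖ t) ⊕ t ≋ 𝟘
      ⊙-distribʳ  : ∀ t a b → (a + b) ⊙ t ≋ a ⊙ t ⊕ b ⊙ t
      ⊙-distribˡ  : ∀ a t u → a ⊙ (t ⊕ u) ≋ a ⊙ t ⊕ a ⊙ u
      ⊙-assoc     : ∀ a b t → (a * b) ⊙ t ≋ a ⊙ (b ⊙ t)
      ⊙-identityˡ : ∀ t → 1# ⊙ t ≋ t
      ⊙-zeroˡ     : ∀ t → 0# ⊙ t ≋ 𝟘
      ⊙-zeroʳ     : ∀ a → a ⊙ 𝟘 ≋ 𝟘

    freeModule : LeftModule R (r ⊔ s) (r ⊔ ℓr ⊔ s ⊔ ℓs)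
    freeModule = record
      { Carrierᴹ = Term
      ; _≈ᴹ_ = _≋_
      ; _+ᴹ_ = _⊕_
      ; _*ₗ_ = _⊙_
      ; 0ᴹ = 𝟘
      ; -ᴹ_ = ⊖_
      ; isLeftModule = record
        { isLeftSemimodule = record
          { +ᴹ-isCommutativeMonoid = record
            { isMonoid = record
              { isSemigroup = record
                { isMagma = record
                  { isEquivalence = record { refl = ≋-refl ; sym = ≋-sym ; trans = ≋-trans }
                  ; ∙-cong = ⊕-cong }
                ; assoc = ⊕-assoc }
              ; identity = ⊕-identityˡ , λ t → ≋-trans (⊕-comm t 𝟘) (⊕-identityˡ t) }
            ; comm = ⊕-comm }
          ; isPreleftSemimodule = record
            { *ₗ-cong = ⊙-cong
            ; *ₗ-zeroˡ = ⊙-zeroˡ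
            ; *ₗ-distribʳ = ⊙-distribʳ
            ; *ₗ-identityˡ = ⊙-identityˡ
            ; *ₗ-assoc = ⊙-assoc
            ; *ₗ-zeroʳ = ⊙-zeroʳ
            ; *ₗ-distribˡ = ⊙-distribˡ } }
        ; -ᴹ‿cong = ⊖-cong
        ; -ᴹ‿inverse = ⊖-inverseˡ , λ t → ≋-trans (⊕-comm t (⊖ t)) (⊖-inverseˡ t) } }

    module _ {m ℓm : Level} (W : LeftModule R m ℓm) (φ : S.Carrier → LeftModule.Carrierᴹ W)
             (φ-cong : ∀ {x y} → x S.≈ y → LeftModule._≈ᴹ_ W (φ x) (φ y)) where

      open LeftModule W

      extend : Term → Carrierᴹ
      extend [ x ]   = φ x
      extend 𝟘       = 0ᴹ
      extend (t ⊕ u) = extend t +ᴹ extend u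
      extend (⊖ t)   = -ᴹ extend t
      extend (a ⊙ t) = a *ₗ extend t

      extend-cong : ∀ {t u} → t ≋ u → extend t ≈ᴹ extend u
      extend-cong ≋-refl              = ≈ᴹ-refl
      extend-cong (≋-sym e)           = ≈ᴹ-sym (extend-cong e)
      extend-cong (≋-trans e f)       = ≈ᴹ-trans (extend-cong e) (extend-cong f)
      extend-cong ([]-cong e)         = φ-cong e
      extend-cong (⊕-cong e f)        = +ᴹ-cong (extend-cong e) (extend-cong f)
      extend-cong (⊖-cong e)          = -ᴹ‿cong (extend-cong e)
      extend-cong (⊙-cong a e)        = *ₗ-cong a (extend-cong e)
      extend-cong (⊕-assoc t u v)     = +ᴹ-assoc _ _ _
      extend-cong (⊕-comm t u)        = +ᴹ-comm _ _
      extend-cong (⊕-identityˡ t)     = +ᴹ-identityˡ _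
      extend-cong (⊖-inverseˡ t)      = -ᴹ‿inverseˡ _
      extend-cong (⊙-distribʳ t a b)  = *ₗ-distribʳ _ _ _
      extend-cong (⊙-distribˡ a t u)  = *ₗ-distribˡ _ _ _
      extend-cong (⊙-assoc a b t)     = *ₗ-assoc _ _ _
      extend-cong (⊙-identityˡ t)     = *ₗ-identityˡ _
      extend-cong (⊙-zeroˡ t)         = *ₗ-zeroˡ _
      extend-cong (⊙-zeroʳ a)         = *ₗ-zeroʳ _

      linearExtension : LinearMap freeModule W
      linearExtension = record
        { apply          = extend
        ; isHomomorphism = record
          { +ᴹ-isGroupHomomorphism = record
            { isMonoidHomomorphism = record
              { isMagmaHomomorphism = record
                { isRelHomomorphism = record { cong = extend-cong }
                ; homo = λ t u → ≈ᴹ-refl }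
              ; ε-homo = ≈ᴹ-refl }
            ; ⁻¹-homo = λ t → ≈ᴹ-refl }
          ; *ₗ-homo = λ a t → ≈ᴹ-refl } }

ℕ⁺ : Set
ℕ⁺ = [ n ∈ ℕ ∣ 1 Nat.≤ n ]

-- Maps f : [d] → ℤ≥1, standing for the words w_f.
Word : ℕ → Set
Word d = Fin d → ℕ⁺

values : ∀ {d} → Word d → Fin d → ℕ
values f i = value (f i)

-- Scalars in an arbitrary commutative ring K; instantiated at the reals below.
module Chromatic {c ℓ : Level} (K : CommutativeRing c ℓ) where

  private module K = CommutativeRing K

  open LinearAlgebra K.ring using (LinearMap; module Free)

  -- The formal series ∑ c_f w_f, where c_f depends only on the set composition type of f.
  record Series (d : ℕ) : Set (c ⊔ ℓ) where
    field
      coeff     : Word d → K.Carrier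
      invariant : ∀ f g → setCompositionType (values f) ≡ setCompositionType (values g) →
                  coeff f K.≈ coeff g

  open Series public

  WQSym : ℕ → LeftModule K.ring (c ⊔ ℓ) ℓ
  WQSym d = record
    { Carrierᴹ = Series d
    ; _≈ᴹ_ = λ p q → ∀ f → coeff p f K.≈ coeff q f
    ; _+ᴹ_ = λ p q → record
      { coeff     = λ f → coeff p f K.+ coeff q f
      ; invariant = λ f g e → K.+-cong (invariant p f g e) (invariant q f g e) }
    ; _*ₗ_ = λ a p → record
      { coeff     = λ f → a K.* coeff p f
      ; invariant = λ f g e → K.*-congˡ (invariant p f g e) }
    ; 0ᴹ = record { coeff = λ f → K.0# ; invariant = λ f g e → K.refl }
    ; -ᴹ_ = λ p → record
      { coeff     = λ f → K.- coeff p f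
      ; invariant = λ f g e → K.-‿cong (invariant p f g e) }
    ; isLeftModule = record
      { isLeftSemimodule = record
        { +ᴹ-isCommutativeMonoid = record
          { isMonoid = record
            { isSemigroup = record
              { isMagma = record
                { isEquivalence = record
                  { refl  = λ f → K.refl
                  ; sym   = λ e f → K.sym (e f)
                  ; trans = λ e e′ f → K.trans (e f) (e′ f) }
                ; ∙-cong = λ e e′ f → K.+-cong (e f) (e′ f) }
              ; assoc = λ p q s f → K.+-assoc _ _ _ }
            ; identity = (λ p f → K.+-identityˡ _) , (λ p f → K.+-identityʳ _) }
          ; comm = λ p q f → K.+-comm _ _ }
        ; isPreleftSemimodule = record
          { *ₗ-cong = λ e e′ f → K.*-cong e (e′ f)
          ; *ₗ-zeroˡ = λ p f → K.zeroˡ _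
          ; *ₗ-distribʳ = λ p a b f → K.distribʳ _ _ _
          ; *ₗ-identityˡ = λ p f → K.*-identityˡ _
          ; *ₗ-assoc = λ a b p f → K.*-assoc _ _ _
          ; *ₗ-zeroʳ = λ a f → K.zeroʳ _
          ; *ₗ-distribˡ = λ a p q f → K.distribˡ _ _ _ } }
      ; -ᴹ‿cong = λ e f → K.-‿cong (e f)
      ; -ᴹ‿inverse = (λ p f → K.-‿inverseˡ _) , (λ p f → K.-‿inverseʳ _) } }

  indicator : Bool → K.Carrier
  indicator b = if b then K.1# else K.0#

  Ψ : ∀ {d} → Matroid d → Series d
  Ψ M = record
    { coeff     = λ f → indicator (does (generic? M (values f)))
    ; invariant = λ f g e → K.reflexive
        (cong indicator (TypeInvariance.generic-resp-type M (values f) (values g) e))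
    }

  Mat : ∀ d → LeftModule K.ring c (c ⊔ ℓ)
  Mat d = Free.freeModule (matroidSetoid d)

  Ψ-linear : ∀ d → LinearMap (Mat d) (WQSym d)
  Ψ-linear d = Free.linearExtension (matroidSetoid d) (WQSym d) Ψ λ {M} {N} e f → K.reflexive
    (cong indicator (TypeInvariance.generic-resp-matroid M N (values f) e))

-- The subset {1, …, k} of [d]; the element i + 1 of [d] is the i of Fin d.
initialSegment : ∀ {d} → ℕ → Subset d
initialSegment k = Vec.tabulate λ i → does (toℕ i ℕₚ.<? k)

-- The proof component of [ A ∈ Subset d ∣ Admissible A ] is irrelevant, so this index type
-- contains each admissible A exactly once.
Admissible : ∀ {d} → Subset d → Set
Admissible {d} A = ∀ k → k Nat.< d → A ≢ initialSegment k

open LinearAlgebra CauchyReals.ring using (LinearlyIndependent; RankAtLeast) public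
open Chromatic CauchyReals.commutativeRing public

{-# OPTIONS --safe #-}
module Submission where

-- Call f degenerate for M if it is not M-generic.  Let A be admissible and A ≠ [d].  Then
-- A = {1, …, x − 1} ∪ … with x ∉ A and some y ∈ A beyond x.  Give A ∖ y distinct large values,
-- x and y the same middle value, and the other elements distinct small values.  This word is
-- degenerate for SM(A), as A and A − y + x both have maximal weight.  If it is degenerate for
-- SM(A′), an exchange at the only tie gives a maximizing basis C of SM(A′) with x ∉ C.  An
-- element z of C outside A would be a small element beyond x, so that C − z + x would be
-- a heavier basis.  Hence C ⊆ A, and C ≤ A′ in the Gale order: with the potential
-- P(A) = ∑_{a ∈ A} (d + 1 − a), P(A′) ≤ P(C) ≤ P(A), and P(A′) = P(A) only if A′ = A.
-- A word with distinct values is generic for every matroid, so a linear relation among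
-- the series of generic words is also one among the series of degenerate words, and the latter is
-- triangular with respect to P.  The remaining index [d] is detected by a constant word.

open import Defs
open import Algebra.Bundles using (CommutativeRing; Ring)
open import Algebra.Module.Bundles using (LeftModule)
import Algebra.Properties.CommutativeMonoid.Sum as MonoidSum
open import Data.Bool.Base using (Bool; true; false; not; if_then_else_)
import Data.Bool.Properties as Boolₚ
open import Data.Empty using (⊥-elim; ⊥-elim-irr)
open import Data.Fin.Base as Fin using (Fin; zero; suc; toℕ; splitAt; join)
import Data.Fin.Properties as Finₚ
open import Data.Fin.Subset using (Subset; inside; outside; ⊥; ⊤; _∈_; _∉_; _⊆_; Nonempty)
import Data.Fin.Subset.Properties as Subₚ
open import Data.Irrelevant using ([_])
open import Data.List.Base using (List; []; _∷_)
import Data.List.Properties as Listₚ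
open import Data.List.Relation.Binary.Pointwise using (Pointwise; []; _∷_)
import Data.List.Relation.Binary.Pointwise as Pointwise
open import Data.Nat.Base using (ℕ; zero; suc; _+_; _∸_; _^_; _≤_; _<_; z≤n; s≤s)
open import Data.Nat.Induction using (<-wellFounded)
import Data.Nat.Properties as ℕₚ
open import Data.Product.Base using (_×_; _,_; ∃; ∃₂; proj₁; proj₂)
open import Data.Refinement using (Refinement-syntax; value; value-injective; _,_)
open import Data.Sum.Base using (_⊎_; inj₁; inj₂)
open import Data.Unit.Base using (tt) renaming (⊤ to ⊤₀)
open import Data.Vec.Base using ([]; _∷_; here; there)
import Data.Vec.Properties as Vecₚ
open import Function.Base using (_∘_)
open import Function.Definitions using (Injective)
open import Induction.WellFounded using (Acc; acc)
open import Level using (Level)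
open import Relation.Binary.PropositionalEquality
  using (_≡_; _≢_; refl; sym; trans; cong; cong₂; subst; subst₂)
open import Relation.Nullary.Decidable
  using (Dec; yes; no; does; ¬?; _×-dec_; _⊎-dec_; T?; toWitness; fromWitness; decidable-stable;
         dec-true; dec-false)
open import Relation.Nullary.Negation using (¬_)

open Matroid using (isBasis; Basis; nonempty; exchange)
open Weights
open Gale

private
  variable
    d : ℕ

-- Maximizing bases and ties in an arbitrary matroid

≢⇒differ : {B C : Subset d} → B ≢ C → ∃ λ z → (z ∈ C × z ∉ B) ⊎ (z ∈ B × z ∉ C)
≢⇒differ {B = B} {C} B≢C = decidable-stable
  (Finₚ.any? λ z → ((z Subₚ.∈? C) ×-dec ¬? (z Subₚ.∈? B)) ⊎-dec ((z Subₚ.∈? B) ×-dec ¬? (z Subₚ.∈? C)))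
  λ ∄ → B≢C (Subₚ.⊆-antisym
    (λ {z} z∈B → decidable-stable (z Subₚ.∈? C) λ z∉C → ∄ (z , inj₂ (z∈B , z∉C)))
    (λ {z} z∈C → decidable-stable (z Subₚ.∈? B) λ z∉B → ∄ (z , inj₁ (z∈C , z∉B))))

module _ (M : Matroid d) (f : Fin d → ℕ) where

  maximizer : ∃ (Maximizes M f)
  maximizer = climb (proj₁ (nonempty M)) (proj₂ (nonempty M)) (<-wellFounded _)
    where
    -- Termination: the weight of [d] bounds every weight, and each improvement shrinks the distance
    -- to it.
    climb : ∀ B → Basis M B → Acc _<_ (weight f ⊤ ∸ weight f B) → ∃ (Maximizes M f)
    climb B b (acc rec)
      with Subₚ.anySubset? (λ B′ → T? (isBasis M B′) ×-dec (weight f B ℕₚ.<? weight f B′))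
    ... | yes (B′ , b′ , lt) =
      climb B′ b′ (rec (ℕₚ.∸-monoʳ-< lt (weight-mono f B′ ⊤ λ _ _ → inj₁ Subₚ.∈⊤)))
    ... | no ∄ = B , b , λ B′ b′ → ℕₚ.≮⇒≥ λ lt → ∄ (B′ , b′ , lt)

  TiedExchange : Set
  TiedExchange = ∃ λ C → ∃₂ λ z w → Maximizes M f C × z ∈ C × w ∉ C × f z ≡ f w ×
                                    Maximizes M f (exchanged C z w)

  -- Exchange out of C an element z at which f is least on the symmetric difference of C and B.
  -- The weight cannot increase, so the element that comes in ties with z.
  ¬generic⇒tiedExchange : ¬ Generic M f → TiedExchange
  ¬generic⇒tiedExchange ¬gen
    with maximizer
  ... | B , maxB
    with Subₚ.anySubset? (λ C → maximizes? M f C ×-dec ¬? (Vecₚ.≡-dec Boolₚ._≟_ B C))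
  ... | no ∄ = ⊥-elim (¬gen (B , maxB , λ {C} maxC →
    decidable-stable (Vecₚ.≡-dec Boolₚ._≟_ B C) λ B≢C → ∄ (C , maxC , B≢C)))
  ... | yes (C , maxC , B≢C)
    with argmin f (λ z → ((z Subₚ.∈? C) ×-dec ¬? (z Subₚ.∈? B)) ⊎-dec
                         ((z Subₚ.∈? B) ×-dec ¬? (z Subₚ.∈? C))) (≢⇒differ B≢C)
  ... | z , z-differs , z-least = split z-differs
    where
    tie : ∀ {P Q} → Maximizes M f P → Maximizes M f Q → z ∈ P → z ∉ Q →
          (∀ w → w ∈ Q → w ∉ P → f z ≤ f w) → TiedExchange
    tie {P} {Q} (p , maxP) (q , _) z∈P z∉Q z≤ with exchange M p q z∈P z∉Q
    ... | w , w∈Q , w∉P , r = P , z , w , (p , maxP) , z∈P , w∉P , fz≡fw , r ,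
      λ B′ b′ → ℕₚ.≤-trans (maxP B′ b′) (ℕₚ.≤-reflexive (sym same))
      where
      e : weight f (exchanged P z w) + f z ≡ weight f P + f w
      e = weight-exchange f P z∈P w∉P
      fw≤fz : f w ≤ f z
      fw≤fz = ℕₚ.+-cancelˡ-≤ (weight f P) (f w) (f z)
        (ℕₚ.≤-trans (ℕₚ.≤-reflexive (sym e)) (ℕₚ.+-monoˡ-≤ (f z) (maxP _ r)))
      fz≡fw : f z ≡ f w
      fz≡fw = ℕₚ.≤-antisym (z≤ w w∈Q w∉P) fw≤fz
      same : weight f (exchanged P z w) ≡ weight f P
      same = ℕₚ.+-cancelʳ-≡ (f z) _ _ (trans e (cong (weight f P +_) (sym fz≡fw)))
    split : (z ∈ C × z ∉ B) ⊎ (z ∈ B × z ∉ C) → TiedExchange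
    split (inj₁ (z∈C , z∉B)) =
      tie maxC maxB z∈C z∉B λ w w∈B w∉C → z-least w (inj₂ (w∈B , w∉C))
    split (inj₂ (z∈B , z∉C)) =
      tie maxB maxC z∈B z∉C λ w w∈C w∉B → z-least w (inj₁ (w∈C , w∉B))

  -- A tied exchange would produce two distinct elements with the same value.
  injective⇒generic : Injective _≡_ _≡_ f → Generic M f
  injective⇒generic inj = decidable-stable (generic? M f) λ ¬gen →
    let C , z , w , _ , z∈C , w∉C , e , _ = ¬generic⇒tiedExchange ¬gen
    in w∉C (subst (_∈ C) (inj e) z∈C)

-- The Gale order and the potential

elements-injective : (A B : Subset d) → elements A ≡ elements B → A ≡ B
elements-injective [] [] e = refl
elements-injective (inside ∷ A) (inside ∷ B) e =
  cong (inside ∷_) (elements-injective A B (Listₚ.map-injective Finₚ.suc-injective (Listₚ.∷-injectiveʳ e)))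
elements-injective (outside ∷ A) (outside ∷ B) e =
  cong (outside ∷_) (elements-injective A B (Listₚ.map-injective Finₚ.suc-injective e))
elements-injective (inside ∷ A) (outside ∷ B) e with elements B
elements-injective (inside ∷ A) (outside ∷ B) () | []
elements-injective (inside ∷ A) (outside ∷ B) () | _ ∷ _
elements-injective (outside ∷ A) (inside ∷ B) e with elements A
elements-injective (outside ∷ A) (inside ∷ B) () | []
elements-injective (outside ∷ A) (inside ∷ B) () | _ ∷ _

sm⁺ : (A B : Subset d) → B ≤ᴳ A → Basis (SM A) B
sm⁺ A B = fromWitness {a? = B ≤ᴳ? A}

sm⁻ : (A B : Subset d) → Basis (SM A) B → B ≤ᴳ A
sm⁻ A B = toWitness {a? = B ≤ᴳ? A}

≤ᴳ-trans : {A B C : Subset d} → A ≤ᴳ B → B ≤ᴳ C → A ≤ᴳ C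
≤ᴳ-trans = Pointwise.transitive ℕₚ.≤-trans

-- By `count⇒≤` it suffices to compare sizes and, for each t, the number of elements up to t;
-- trading z for the smaller x can only raise the latter.
exchanged-≤ᴳ : (B : Subset d) {x z : Fin d} → z ∈ B → x ∉ B → x Fin.< z → exchanged B z x ≤ᴳ B
exchanged-≤ᴳ B {x} {z} z∈B x∉B x<z =
  count⇒≤ _ _ (elements-sorted C) (elements-sorted B)
    (ℕₚ.+-cancelʳ-≡ 1 _ _ (weight-exchange (λ _ → 1) B z∈B x∉B))
    λ t → ℕₚ.+-cancelʳ-≤ (χ t x) _ _ (ℕₚ.≤-trans
      (ℕₚ.≤-reflexive (sym (weight-exchange (χ t) B z∈B x∉B)))
      (ℕₚ.+-monoʳ-≤ (weight (χ t) C) (χ-anti t (ℕₚ.<⇒≤ x<z))))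
  where
  C = exchanged B z x

-- The index i stands for the element a = i + 1 of [d], so this is d + 1 - a. It is always positive,
-- which makes the potential strictly increasing under inclusion.
gap : Fin d → ℕ
gap {d} i = d ∸ toℕ i

potential : Subset d → ℕ
potential = weight gap

-- The weak bound is carried along because a strict drop at the head still needs a weak comparison
-- of the tails.
pointwise-potential : {xs ys : List (Fin d)} → Pointwise Fin._≤_ xs ys →
  count gap ys ≤ count gap xs × (xs ≡ ys ⊎ count gap ys < count gap xs)
pointwise-potential [] = z≤n , inj₁ refl
pointwise-potential {d} {x ∷ _} {y ∷ _} (p ∷ ps)
  with pointwise-potential ps | ℕₚ.m≤n⇒m<n∨m≡n p
-- Since y lies below d, the truncated subtraction is strict here.
... | le , _       | inj₁ x<y = let lt = ℕₚ.∸-monoʳ-< x<y (ℕₚ.<⇒≤ (Finₚ.toℕ<n y)) in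
  ℕₚ.+-mono-≤ (ℕₚ.<⇒≤ lt) le , inj₂ (ℕₚ.+-mono-<-≤ lt le)
... | le , inj₂ lt | inj₂ x≡y = let e = ℕₚ.∸-monoʳ-≤ d p in
  ℕₚ.+-mono-≤ e le , inj₂ (ℕₚ.+-mono-≤-< e lt)
... | le , inj₁ refl | inj₂ x≡y with Finₚ.toℕ-injective x≡y
... | refl = ℕₚ.≤-refl , inj₁ refl

≤ᴳ-potential : {C A : Subset d} → C ≤ᴳ A → C ≡ A ⊎ potential A < potential C
≤ᴳ-potential {C = C} {A} C≤A with proj₂ (pointwise-potential C≤A)
... | inj₁ e  = inj₁ (elements-injective C A e)
... | inj₂ lt = inj₂ lt

⊆-potential : {C A : Subset d} → C ⊆ A → C ≡ A ⊎ potential C < potential A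
⊆-potential {C = C} {A} C⊆A with Vecₚ.≡-dec Boolₚ._≟_ C A
... | yes e  = inj₁ e
... | no C≢A with ≢⇒differ C≢A
... | z , inj₂ (z∈C , z∉A) = ⊥-elim (z∉A (C⊆A z∈C))
... | z , inj₁ (z∈A , z∉C) = inj₂ (ℕₚ.<-≤-trans
  (ℕₚ.+-monoˡ-< (potential C) (ℕₚ.m<n⇒0<n∸m (Finₚ.toℕ<n z)))
  (weight-mono-extra gap C A z∈A z∉C λ _ w∈C → inj₁ (C⊆A w∈C)))

≤ᴳ-⊆-potential : {C A A′ : Subset d} → C ≤ᴳ A′ → C ⊆ A → A′ ≡ A ⊎ potential A′ < potential A
≤ᴳ-⊆-potential {C = C} {A} {A′} C≤A′ C⊆A
  with ≤ᴳ-potential {C = C} {A′} C≤A′ | ⊆-potential {C = C} {A} C⊆A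
... | inj₁ refl | r         = r
... | inj₂ lt   | inj₁ refl = inj₂ lt
... | inj₂ lt   | inj₂ lt′  = inj₂ (ℕₚ.<-trans lt lt′)

-- Words degenerate for a Schubert matroid

-- Both sides are padded to ∣A∣ + ∣B∣ values, so that equal sizes need not be assumed.
weight-threshold : ∀ t (f : Fin d → ℕ) (A B : Subset d) →
  (∀ i → i ∈ A → t ≤ f i) → (∀ i → i ∉ A → f i ≤ t) →
  weight f B + weight (λ _ → t) A ≤ weight f A + weight (λ _ → t) B
weight-threshold t f [] [] lo hi = z≤n
weight-threshold t f (a ∷ A) (b ∷ B) lo hi = step a b (lo zero) (hi zero)
  where
  ih : weight (f ∘ suc) B + weight (λ _ → t) A ≤ weight (f ∘ suc) A + weight (λ _ → t) B
  ih = weight-threshold t (f ∘ suc) A B (λ i i∈A → lo (suc i) (there i∈A))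
    (λ i i∉A → hi (suc i) λ { (there i∈A) → i∉A i∈A })
  interchange : ∀ p w q v → (p + w) + (q + v) ≡ (p + q) + (w + v)
  interchange p w q v = trans (ℕₚ.+-assoc p w (q + v))
    (trans (cong (p +_) (+-left-comm w q v)) (sym (ℕₚ.+-assoc p q (w + v))))
  step : ∀ a b → (zero ∈ a ∷ A → t ≤ f zero) → (zero ∉ a ∷ A → f zero ≤ t) →
         weight f (b ∷ B) + weight (λ _ → t) (a ∷ A) ≤ weight f (a ∷ A) + weight (λ _ → t) (b ∷ B)
  step inside inside l h
    rewrite weight-in f B | weight-in (λ _ → t) A | weight-in f A | weight-in (λ _ → t) B
    = subst₂ _≤_ (sym (interchange (f zero) _ t _)) (sym (interchange (f zero) _ t _))
        (ℕₚ.+-monoʳ-≤ (f zero + t) ih)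
  step inside outside l h
    rewrite weight-out f B | weight-in (λ _ → t) A | weight-in f A | weight-out (λ _ → t) B
    = subst₂ _≤_ (sym (+-left-comm (weight (f ∘ suc) B) t _)) (sym (ℕₚ.+-assoc (f zero) _ _))
        (ℕₚ.+-mono-≤ (l here) ih)
  step outside inside l h
    rewrite weight-in f B | weight-out (λ _ → t) A | weight-out f A | weight-in (λ _ → t) B
    = subst₂ _≤_ (sym (ℕₚ.+-assoc (f zero) _ _)) (sym (+-left-comm (weight (f ∘ suc) A) t _))
        (ℕₚ.+-mono-≤ (h λ ()) ih)
  step outside outside l h
    rewrite weight-out f B | weight-out (λ _ → t) A | weight-out f A | weight-out (λ _ → t) B
    = ih

pointwise-count-const : ∀ t {xs ys : List (Fin d)} → Pointwise Fin._≤_ xs ys →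
                        count (λ _ → t) xs ≡ count (λ _ → t) ys
pointwise-count-const t []       = refl
pointwise-count-const t (_ ∷ ps) = cong (t +_) (pointwise-count-const t ps)

-- All bases have the size of A, and A collects the elements on the heavy side of the threshold f y,
-- so A is maximizing. Trading y for the smaller x goes down in the Gale order and keeps the weight,
-- which gives a second maximizing basis.
SM-¬generic : (A : Subset d) (f : Fin d → ℕ) {x y : Fin d} → x ∉ A → y ∈ A → x Fin.< y → f y ≡ f x →
              (∀ i → i ∈ A → f y ≤ f i) → (∀ i → i ∉ A → f i ≤ f y) → ¬ Generic (SM A) f
SM-¬generic A f {x} {y} x∉A y∈A x<y fy≡fx lo hi (B , _ , unique) =
  x∉A (subst (x ∈_) (trans (sym (unique maxE)) (unique maxA)) (y∈exchanged A y x))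
  where
  A-max : ∀ B′ → Basis (SM A) B′ → weight f B′ ≤ weight f A
  A-max B′ b′ = ℕₚ.+-cancelʳ-≤ (weight (λ _ → f y) A) _ _
    (ℕₚ.≤-trans (weight-threshold (f y) f A B′ lo hi)
      (ℕₚ.≤-reflexive (cong (weight f A +_) (pointwise-count-const (f y) (sm⁻ A B′ b′)))))
  maxA : Maximizes (SM A) f A
  maxA = sm⁺ A A (≤ᴳ-refl A) , A-max
  same : weight f (exchanged A y x) ≡ weight f A
  same = ℕₚ.+-cancelʳ-≡ (f y) _ _
    (trans (weight-exchange f A y∈A x∉A) (cong (weight f A +_) (sym fy≡fx)))
  maxE : Maximizes (SM A) f (exchanged A y x)
  maxE = sm⁺ A (exchanged A y x) (exchanged-≤ᴳ A y∈A x∉A x<y) ,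
    λ B′ b′ → ℕₚ.≤-trans (A-max B′ b′) (ℕₚ.≤-reflexive (sym same))

-- The word attached to a set with a gap

-- x + 1 is the least element of [d] outside A, and A is not an initial segment.
record Gap (A : Subset d) : Set where
  field
    x y    : Fin d
    x∉A    : x ∉ A
    y∈A    : y ∈ A
    x<y    : x Fin.< y
    before : ∀ z → z Fin.< x → z ∈ A

module TieWord (A : Subset d) (G : Gap A) where

  open Gap G

  -- The heights lie in d + 2, ..., 2d + 1 for `high`, equal d + 1 for `mid`, and lie in 1, ..., d
  -- for `low`, so two distinct elements can tie only in `mid`. As a relation, it allows case
  -- analysis without repeating the decisions made in `tier`, which tests for x and y before
  -- membership in A.
  data Tier (i : Fin d) : ℕ → Set where
    high : i ∈ A → Tier i (suc d + suc (toℕ i))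
    mid  : i ≡ x ⊎ i ≡ y → Tier i (suc d)
    low  : i ∉ A → i ≢ x → Tier i (suc (toℕ i))

  tier : ∀ i → ∃ (Tier i)
  tier i with i Finₚ.≟ x | i Finₚ.≟ y | i Subₚ.∈? A
  ... | yes e  | _      | _       = _ , mid (inj₁ e)
  ... | no _   | yes e  | _       = _ , mid (inj₂ e)
  ... | no i≢x | no _   | no i∉A  = _ , low i∉A i≢x
  ... | no _   | no _   | yes i∈A = _ , high i∈A

  height : Fin d → ℕ
  height i = proj₁ (tier i)

  height-x : height x ≡ suc d
  height-x with x Finₚ.≟ x
  ... | yes _  = refl
  ... | no x≢x = ⊥-elim (x≢x refl)

  height-y : height y ≡ suc d
  height-y with y Finₚ.≟ x | y Finₚ.≟ y
  ... | yes _ | _      = refl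
  ... | no _  | yes _  = refl
  ... | no _  | no y≢y = ⊥-elim (y≢y refl)

  tier>0 : ∀ {i n} → Tier i n → 1 ≤ n
  tier>0 (high _)  = s≤s z≤n
  tier>0 (mid _)   = s≤s z≤n
  tier>0 (low _ _) = s≤s z≤n

  low<suc-d : ∀ (i : Fin d) → suc (toℕ i) < suc d
  low<suc-d i = s≤s (Finₚ.toℕ<n i)

  suc-d<high : ∀ (i : Fin d) → suc d < suc d + suc (toℕ i)
  suc-d<high i = ℕₚ.m<m+n (suc d) (s≤s z≤n)

  tier-∈ : ∀ {i n} → Tier i n → i ∈ A → suc d ≤ n
  tier-∈ {i} (high _)    _   = ℕₚ.<⇒≤ (suc-d<high i)
  tier-∈     (mid _)     _   = ℕₚ.≤-refl
  tier-∈     (low i∉A _) i∈A = ⊥-elim (i∉A i∈A)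

  tier-∉ : ∀ {i n} → Tier i n → i ∉ A → n ≤ suc d
  tier-∉     (high i∈A) i∉A = ⊥-elim (i∉A i∈A)
  tier-∉     (mid _)    _   = ℕₚ.≤-refl
  tier-∉ {i} (low _ _)  _   = ℕₚ.<⇒≤ (low<suc-d i)

  tier-tie : ∀ {i j m n} → Tier i m → Tier j n → m ≡ n → i ≡ j ⊎ (i ≡ x ⊎ i ≡ y) × (j ≡ x ⊎ j ≡ y)
  tier-tie (high _) (high _) e =
    inj₁ (Finₚ.toℕ-injective (ℕₚ.suc-injective (ℕₚ.+-cancelˡ-≡ (suc d) _ _ e)))
  tier-tie {i} (high _) (mid _) e = ⊥-elim (ℕₚ.<-irrefl (sym e) (suc-d<high i))
  tier-tie {i} {j} (high _) (low _ _) e =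
    ⊥-elim (ℕₚ.<-irrefl (sym e) (ℕₚ.<-trans (low<suc-d j) (suc-d<high i)))
  tier-tie {j = j} (mid _) (high _) e = ⊥-elim (ℕₚ.<-irrefl e (suc-d<high j))
  tier-tie (mid p) (mid q) e = inj₂ (p , q)
  tier-tie {j = j} (mid _) (low _ _) e = ⊥-elim (ℕₚ.<-irrefl (sym e) (low<suc-d j))
  tier-tie {i} {j} (low _ _) (high _) e =
    ⊥-elim (ℕₚ.<-irrefl e (ℕₚ.<-trans (low<suc-d i) (suc-d<high j)))
  tier-tie {i} (low _ _) (mid _) e = ⊥-elim (ℕₚ.<-irrefl e (low<suc-d i))
  tier-tie (low _ _) (low _ _) e = inj₁ (Finₚ.toℕ-injective (ℕₚ.suc-injective e))

  word : Word d
  word i = height i , [ tier>0 (proj₂ (tier i)) ]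

  SM-¬generic-word : ¬ Generic (SM A) height
  SM-¬generic-word = SM-¬generic A height x∉A y∈A x<y (trans height-y (sym height-x))
    (λ i i∈A → subst (_≤ height i) (sym height-y) (tier-∈ (proj₂ (tier i)) i∈A))
    (λ i i∉A → subst (height i ≤_) (sym height-y) (tier-∉ (proj₂ (tier i)) i∉A))

  ∉⇒x< : ∀ z → z ∉ A → z ≢ x → x Fin.< z
  ∉⇒x< z z∉A z≢x = ℕₚ.≤∧≢⇒< (ℕₚ.≮⇒≥ λ z<x → z∉A (before z z<x))
    λ e → z≢x (Finₚ.toℕ-injective (sym e))

  -- The tied exchange swaps x and y in one direction or the other: x is missing either after the
  -- exchange or before it.
  avoids-x : ∀ A′ → ¬ Generic (SM A′) height → ∃ λ C → Maximizes (SM A′) height C × x ∉ C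
  avoids-x A′ ¬gen with ¬generic⇒tiedExchange (SM A′) height ¬gen
  ... | C , z , w , maxC , z∈C , w∉C , e , maxE with tier-tie (proj₂ (tier z)) (proj₂ (tier w)) e
  ... | inj₁ refl                    = ⊥-elim (w∉C z∈C)
  ... | inj₂ (inj₁ refl , _)         = _ , maxE , x∉exchanged C w∉C z∈C
  ... | inj₂ (inj₂ refl , inj₁ refl) = C , maxC , w∉C
  ... | inj₂ (inj₂ refl , inj₂ refl) = ⊥-elim (w∉C z∈C)

  maximizer-⊆ : ∀ A′ C → Maximizes (SM A′) height C → x ∉ C → C ⊆ A
  maximizer-⊆ A′ C (c , maxC) x∉C {z} z∈C = decidable-stable (z Subₚ.∈? A) λ z∉A →
    ℕₚ.<⇒≱ (heavier z∉A (proj₂ (tier z)) refl)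
      (maxC (exchanged C z x) (sm⁺ A′ (exchanged C z x) (≤ᴳ-trans {A = exchanged C z x} {C} {A′}
        (exchanged-≤ᴳ C z∈C x∉C (∉⇒x< z z∉A z≢x)) (sm⁻ A′ C c))))
    where
    z≢x : z ≢ x
    z≢x refl = x∉C z∈C
    small : z ∉ A → ∀ {n} → Tier z n → n < suc d
    small z∉A (high z∈A)        = ⊥-elim (z∉A z∈A)
    small z∉A (mid (inj₁ e))    = ⊥-elim (z≢x e)
    small z∉A (mid (inj₂ refl)) = ⊥-elim (z∉A y∈A)
    small z∉A (low _ _)         = low<suc-d z
    heavier : z ∉ A → ∀ {n} → Tier z n → height z ≡ n → weight height C < weight height (exchanged C z x)
    heavier z∉A t e = ℕₚ.+-cancelʳ-< (height z) _ _ (ℕₚ.<-≤-trans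
      (ℕₚ.+-monoʳ-< (weight height C) (subst₂ _<_ (sym e) (sym height-x) (small z∉A t)))
      (ℕₚ.≤-reflexive (sym (weight-exchange height C z∈C x∉C))))

  ¬generic⇒potential : ∀ A′ → ¬ Generic (SM A′) height → A′ ≡ A ⊎ potential A′ < potential A
  ¬generic⇒potential A′ ¬gen with avoids-x A′ ¬gen
  ... | C , maxC , x∉C =
    ≤ᴳ-⊆-potential (sm⁻ A′ C (proj₁ maxC)) (maximizer-⊆ A′ C maxC x∉C)

-- Admissible sets, and the constant and increasing words

initialSegment-zero : initialSegment {d} 0 ≡ ⊥
initialSegment-zero {zero}  = refl
initialSegment-zero {suc d} = cong (outside ∷_) initialSegment-zero

admissible-tail : {A : Subset d} → Admissible (inside ∷ A) → Admissible A
admissible-tail adm k k<d e = adm (suc k) (s≤s k<d) (cong (inside ∷_) e)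

admissible-inside : {A : Subset d} → Admissible A → Admissible (inside ∷ A)
admissible-inside adm zero    _         ()
admissible-inside adm (suc k) (s≤s k<d) e = adm k k<d (Vecₚ.∷-injectiveʳ e)

-- The only initial segment that omits the first element is the empty one.
admissible-outside : {A : Subset d} → A ≢ ⊥ → Admissible (outside ∷ A)
admissible-outside A≢⊥ zero    _ e = A≢⊥ (trans (Vecₚ.∷-injectiveʳ e) initialSegment-zero)
admissible-outside A≢⊥ (suc k) _ ()

gap-inside : {A : Subset d} → Gap A → Gap (inside ∷ A)
gap-inside G = record
  { x = suc x ; y = suc y
  ; x∉A = λ { (there x∈A) → x∉A x∈A } ; y∈A = there y∈A ; x<y = s≤s x<y
  ; before = λ { zero _ → here ; (suc z) (s≤s z<x) → there (before z z<x) } }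
  where open Gap G

gap-outside : {A : Subset d} → Nonempty A → Gap (outside ∷ A)
gap-outside (y , y∈A) = record
  { x = zero ; y = suc y ; x∉A = λ () ; y∈A = there y∈A ; x<y = s≤s z≤n ; before = λ z () }

-- After the leading run of members, the first omitted element is x, and any later member serves as
-- y.
full-or-gap : (A : Subset d) → .(Admissible A) → A ≡ ⊤ ⊎ Gap A
full-or-gap []            adm = inj₁ refl
full-or-gap (inside ∷ A)  adm with full-or-gap A (admissible-tail adm)
... | inj₁ e = inj₁ (cong (inside ∷_) e)
... | inj₂ G = inj₂ (gap-inside G)
full-or-gap (outside ∷ A) adm with Subₚ.nonempty? A
... | yes ne = inj₂ (gap-outside ne)
-- No later member exists, so the whole set is an initial segment. Admissibility is irrelevant and
-- may only refute this case; the case itself is found by deciding nonemptiness.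
... | no ∅   = ⊥-elim-irr (adm 0 (s≤s z≤n)
  (cong (outside ∷_) (trans (Subₚ.Empty-unique ∅) (sym initialSegment-zero))))

constantWord : Word d
constantWord _ = 1 , [ s≤s z≤n ]

-- [d] is the only basis: for any other B, B ⊆ [d] and B ≤ᴳ [d] force opposite strict inequalities
-- of potentials.
⊤-generic-constant : Generic (SM (⊤ {d})) (values constantWord)
⊤-generic-constant {d} = ⊤ ,
  (sm⁺ ⊤ ⊤ (≤ᴳ-refl ⊤) , λ B b → ℕₚ.≤-reflexive (≤⇒size (sm⁻ ⊤ B b))) , λ {B} (b , _) →
  sym (full B (sm⁻ ⊤ B b))
  where
  full : ∀ B → B ≤ᴳ ⊤ → B ≡ ⊤
  full B B≤⊤ with ⊆-potential {C = B} (Subₚ.⊆-max B) | ≤ᴳ-potential {C = B} B≤⊤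
  ... | inj₁ e  | _       = e
  ... | inj₂ _  | inj₁ e  = e
  ... | inj₂ lt | inj₂ gt = ⊥-elim (ℕₚ.<-asym lt gt)

gap-¬generic-constant : {A : Subset d} → Gap A → ¬ Generic (SM A) (values constantWord)
gap-¬generic-constant {A = A} G =
  SM-¬generic A _ x∉A y∈A x<y refl (λ _ _ → ℕₚ.≤-refl) (λ _ _ → ℕₚ.≤-refl)
  where open Gap G

-- Every Ψ(M) has coefficient 1 at this word, so the coefficients of a linear relation sum to zero.
increasingWord : Word d
increasingWord i = suc (toℕ i) , [ s≤s z≤n ]

generic-increasing : (M : Matroid d) → Generic M (values increasingWord)
generic-increasing M =
  injective⇒generic M _ λ e → Finₚ.toℕ-injective (ℕₚ.suc-injective e)

-- Triangular systems with entries 0 and 1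

module TriangularSystem {r ℓ : Level} (R : Ring r ℓ) where

  open Ring R using (Carrier; _≈_; 0#; 1#; _*_; +-commutativeMonoid; +-identityʳ; +-identityˡ;
    +-cong; +-congˡ; zeroʳ; zeroˡ; *-identityʳ; *-congʳ)
    renaming (_+_ to _⊞_; sym to ≈-sym; trans to ≈-trans)
  open MonoidSum +-commutativeMonoid using () renaming (sum to ∑; sum-cong-≋ to ∑-cong;
    sum-remove to ∑-remove; sum-replicate-zero to ∑-replicate-zero; ∑-distrib-+ to ∑-distrib-⊞)

  iverson : Bool → Carrier
  iverson b = if b then 1# else 0#

  ∑-zero : ∀ {n} {t : Fin n → Carrier} → (∀ j → t j ≈ 0#) → ∑ t ≈ 0#
  ∑-zero {n} t≈0 = ≈-trans (∑-cong t≈0) (∑-replicate-zero n)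

  ∑-single : ∀ {n} (t : Fin n → Carrier) k → (∀ j → j ≢ k → t j ≈ 0#) → ∑ t ≈ t k
  ∑-single {suc n} t k t≈0 = ≈-trans (∑-remove {i = k} t) (≈-trans
    (+-congˡ (∑-zero λ j → t≈0 (Fin.punchIn k j) (Finₚ.punchInᵢ≢i k j)))
    (+-identityʳ (t k)))

  -- Term by term, the sums over b and over its negation add up to ∑ c.
  ∑-complement : ∀ {n} (c : Fin n → Carrier) (b : Fin n → Bool) → ∑ c ≈ 0# →
    ∑ (λ j → c j * iverson (b j)) ≈ 0# → ∑ (λ j → c j * iverson (not (b j))) ≈ 0#
  ∑-complement c b ∑c ∑cb = ≈-trans (≈-sym (+-identityʳ _)) (≈-trans (+-congˡ (≈-sym ∑cb))
    (≈-trans (≈-sym (∑-distrib-⊞ (λ j → c j * iverson (not (b j))) (λ j → c j * iverson (b j))))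
      (≈-trans (∑-cong λ j → merge (c j) (b j)) ∑c)))
    where
    merge : ∀ a b → (a * iverson (not b)) ⊞ (a * iverson b) ≈ a
    merge a true  = ≈-trans (+-cong (zeroʳ a) (*-identityʳ a)) (+-identityˡ a)
    merge a false = ≈-trans (+-cong (*-identityʳ a) (zeroʳ a)) (+-identityʳ a)

  -- Each k brings its own equation, so different rows may come from different words and from either
  -- generic or degenerate coefficients. Ranks may coincide for different indices; off the diagonal,
  -- only strictly smaller ranks may occur.
  record Row {n} (c : Fin n → Carrier) (rank : Fin n → ℕ) (k : Fin n) : Set ℓ where
    field
      entry    : Fin n → Bool
      equation : ∑ (λ j → c j * iverson (entry j)) ≈ 0#
      diagonal : entry k ≡ true
      below    : ∀ j → entry j ≡ true → j ≡ k ⊎ rank j < rank k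

  triangular⇒zero : ∀ {n} {c : Fin n → Carrier} {rank : Fin n → ℕ} → (∀ k → Row c rank k) → ∀ k → c k ≈ 0#
  triangular⇒zero {c = c} {rank} row k = solve k (<-wellFounded (rank k))
    where
    solve : ∀ k → Acc _<_ (rank k) → c k ≈ 0#
    solve k (acc rec) = ≈-trans (≈-sym here-only) (≈-trans
      (≈-sym (∑-single (λ j → c j * iverson (entry j)) k elsewhere)) equation)
      where
      open Row (row k)
      here-only : c k * iverson (entry k) ≈ c k
      here-only rewrite diagonal = *-identityʳ (c k)
      elsewhere : ∀ j → j ≢ k → c j * iverson (entry j) ≈ 0#
      elsewhere j j≢k with entry j | below j
      ... | false | _ = zeroʳ (c j)
      ... | true  | h with h refl
      ... | inj₁ j≡k = ⊥-elim (j≢k j≡k)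
      ... | inj₂ lt  = ≈-trans (*-congʳ (solve j (rec lt))) (zeroˡ 1#)

not-does : ∀ {p} {P : Set p} (P? : Dec P) → not (does P?) ≡ true → ¬ P
not-does (no ¬p) refl = ¬p

does⇒ : ∀ {p} {P : Set p} (P? : Dec P) → does P? ≡ true → P
does⇒ (yes p) refl = p

-- Linear independence

module _ {r ℓ : Level} (K : CommutativeRing r ℓ) where

  private
    module K = CommutativeRing K
    module C = Chromatic K
  open TriangularSystem K.ring
  open MonoidSum K.+-commutativeMonoid using () renaming (sum to ∑; sum-cong-≋ to ∑-cong)

  coeff-∑ : ∀ {d n} (v : Fin n → C.Series d) (f : Word d) →
    C.coeff (MonoidSum.sum (LeftModule.+ᴹ-commutativeMonoid (C.WQSym d)) v) f ≡ ∑ (λ k → C.coeff (v k) f)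
  coeff-∑ {n = zero}  v f = refl
  coeff-∑ {n = suc n} v f = cong (C.coeff (v zero) f K.+_) (coeff-∑ (v ∘ suc) f)

  SM-independent : ∀ d → LinearAlgebra.LinearlyIndependent K.ring (C.WQSym d)
    (λ (A : [ A ∈ Subset d ∣ Admissible A ]) → C.Ψ (SM (value A)))
  SM-independent d {n} ι ι-injective c relation =
    triangular⇒zero {rank = λ j → potential (A j)} λ k → row k (full-or-gap′ (ι k))
    where
    A : Fin n → Subset d
    A j = value (ι j)

    A-injective : ∀ {j k} → A j ≡ A k → j ≡ k
    A-injective e = ι-injective (value-injective e)

    full-or-gap′ : (B : [ B ∈ Subset d ∣ Admissible B ]) → value B ≡ ⊤ ⊎ Gap (value B)
    full-or-gap′ (B , [ adm ]) = full-or-gap B adm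

    test : ∀ f j → Dec (Generic (SM (A j)) (values f))
    test f j = generic? (SM (A j)) (values f)

    at : ∀ f → ∑ (λ j → c j K.* iverson (does (test f j))) K.≈ K.0#
    at f = K.trans (K.reflexive (sym (coeff-∑ (λ j → c j *ₗ C.Ψ (SM (A j))) f))) (relation f)
      where open LeftModule (C.WQSym d) using (_*ₗ_)

    ∑c≈0 : ∑ c K.≈ K.0#
    ∑c≈0 = K.trans (∑-cong λ j → K.sym (K.trans
      (K.*-congˡ (K.reflexive (cong iverson (dec-true (test increasingWord j) (generic-increasing (SM (A j)))))))
      (K.*-identityʳ (c j)))) (at increasingWord)

    row : ∀ k → A k ≡ ⊤ ⊎ Gap (A k) → Row c (λ j → potential (A j)) k
    -- Among the admissible sets only [d] is generic at the constant word, so this row has no entry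
    -- off the diagonal.
    row k (inj₁ Ak≡⊤) = record
      { entry    = λ j → does (test constantWord j)
      ; equation = at constantWord
      ; diagonal = dec-true (test constantWord k)
          (subst (λ B → Generic (SM B) (values constantWord)) (sym Ak≡⊤) ⊤-generic-constant)
      ; below    = λ j e → inj₁ (only j (does⇒ (test constantWord j) e) (full-or-gap′ (ι j)))
      }
      where
      only : ∀ j → Generic (SM (A j)) (values constantWord) → A j ≡ ⊤ ⊎ Gap (A j) → j ≡ k
      only j gen (inj₁ Aj≡⊤) = A-injective (trans Aj≡⊤ (sym Ak≡⊤))
      only j gen (inj₂ G)    = ⊥-elim (gap-¬generic-constant G gen)
    row k (inj₂ G) = record
      { entry    = λ j → not (does (test word j))
      ; equation = ∑-complement c (λ j → does (test word j)) ∑c≈0 (at word)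
      ; diagonal = cong not (dec-false (test word k) SM-¬generic-word)
      ; below    = λ j e → lower j (¬generic⇒potential (A j) (not-does (test word j) e))
      }
      where
      open TieWord (A k) G
      lower : ∀ j → A j ≡ A k ⊎ potential (A j) < potential (A k) → j ≡ k ⊎ potential (A j) < potential (A k)
      lower j (inj₁ e)  = inj₁ (A-injective e)
      lower j (inj₂ lt) = inj₂ lt

-- Counting the admissible sets, and the rank

record Enumeration (P : Subset d → Set) (n : ℕ) : Set where
  field
    subset    : Fin n → Subset d
    injective : ∀ {i j} → subset i ≡ subset j → i ≡ j
    satisfies : ∀ i → P (subset i)

open Enumeration

append : ∀ {P Q : Subset d → Set} {R : Subset (suc d) → Set} {m n} →
  (∀ {A} → P A → R (inside ∷ A)) → (∀ {A} → Q A → R (outside ∷ A)) →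
  Enumeration P m → Enumeration Q n → Enumeration R (m + n)
append {d} {R = R} {m} {n} p q E F = record
  { subset    = λ i → pick (splitAt m i)
  ; injective = λ {i} {j} e → trans (sym (Finₚ.join-splitAt m n i))
      (trans (cong (join m n) (pick-injective (splitAt m i) (splitAt m j) e)) (Finₚ.join-splitAt m n j))
  ; satisfies = λ i → pick-satisfies (splitAt m i)
  }
  where
  pick : Fin m ⊎ Fin n → Subset (suc d)
  pick (inj₁ i) = inside ∷ subset E i
  pick (inj₂ i) = outside ∷ subset F i
  pick-injective : ∀ s t → pick s ≡ pick t → s ≡ t
  pick-injective (inj₁ i) (inj₁ j) e = cong inj₁ (injective E (Vecₚ.∷-injectiveʳ e))
  pick-injective (inj₂ i) (inj₂ j) e = cong inj₂ (injective F (Vecₚ.∷-injectiveʳ e))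
  pick-injective (inj₁ i) (inj₂ j) ()
  pick-injective (inj₂ i) (inj₁ j) ()
  pick-satisfies : ∀ s → R (pick s)
  pick-satisfies (inj₁ i) = p (satisfies E i)
  pick-satisfies (inj₂ i) = q (satisfies F i)

singleton : {P : Subset 0 → Set} → P [] → Enumeration P 1
singleton p = record
  { subset = λ _ → [] ; injective = λ { {zero} {zero} _ → refl } ; satisfies = λ _ → p }

subsets : ∀ d → Enumeration {d} (λ _ → ⊤₀) (2 ^ d)
subsets zero    = singleton tt
subsets (suc d) = append _ _ (subsets d) (subst (Enumeration _) (sym (ℕₚ.+-identityʳ (2 ^ d))) (subsets d))

-- The number of sets is given by an equation, which avoids truncated subtraction.
nonempties : ∀ d → ∃ λ n → suc n ≡ 2 ^ d × Enumeration {d} (_≢ ⊥) n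
nonempties zero = 0 , refl , record { subset = λ () ; injective = λ { {()} } ; satisfies = λ () }
nonempties (suc d) with nonempties d
... | n , e , E = 2 ^ d + n ,
  trans (sym (ℕₚ.+-suc (2 ^ d) n)) (cong (2 ^ d +_) (trans e (sym (ℕₚ.+-identityʳ (2 ^ d))))) ,
  append (λ _ ()) (λ A≢⊥ e → A≢⊥ (Vecₚ.∷-injectiveʳ e)) (subsets d) E

-- A set containing the first element is admissible if the rest is, and a set omitting it if the
-- rest is nonempty. The count is (2^d - d) + (2^d - 1) = 2^(d+1) - (d + 1).
admissibles : ∀ d → ∃ λ n → n + d ≡ 2 ^ d × Enumeration {d} Admissible n
-- For d = 0 no k is excluded, and the empty set counts as [0].
admissibles zero = 1 , refl , singleton λ _ ()
admissibles (suc d) with admissibles d | nonempties d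
... | m , e , E | n , e′ , F = m + n , size , append admissible-inside admissible-outside E F
  where
  size : (m + n) + suc d ≡ 2 ^ suc d
  size = trans (ℕₚ.+-assoc m n (suc d)) (trans (cong (m +_)
    (trans (ℕₚ.+-suc n d) (trans (cong suc (ℕₚ.+-comm n d)) (sym (ℕₚ.+-suc d n)))))
    (trans (sym (ℕₚ.+-assoc m d (suc n)))
      (cong₂ _+_ e (trans e′ (sym (ℕₚ.+-identityʳ (2 ^ d)))))))

admissible-enumeration : Enumeration {d} Admissible (2 ^ d ∸ d)
admissible-enumeration {d} with admissibles d
... | n , e , E = subst (Enumeration Admissible) (trans (sym (ℕₚ.m+n∸n≡m n d)) (cong (_∸ d) e)) E

admissible-subset : Fin (2 ^ d ∸ d) → [ A ∈ Subset d ∣ Admissible A ]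
admissible-subset i = subset admissible-enumeration i , [ satisfies admissible-enumeration i ]

module _ {r ℓ : Level} (K : CommutativeRing r ℓ) where

  open LinearAlgebra (CommutativeRing.ring K) using (module Free)

  -- On a generator the linear extension computes to Ψ itself, so a relation among the images is one
  -- among distinct admissible Schubert matroids.
  SM-rank : ∀ d → LinearAlgebra.RankAtLeast (CommutativeRing.ring K) (Chromatic.Ψ-linear K d) (2 ^ d ∸ d)
  SM-rank d = (λ i → Free.[ SM (value (admissible-subset i)) ]) , λ ι ι-injective →
    SM-independent K d (admissible-subset ∘ ι)
      λ e → ι-injective (injective admissible-enumeration (cong value e))

theorem4p9 : ∀ (d : ℕ) →
    LinearlyIndependent (WQSym d) (λ (A : [ A ∈ Subset d ∣ Admissible A ]) → Ψ (SM (value A)))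
    × RankAtLeast (Ψ-linear d) (2 ^ d ∸ d)
theorem4p9 d = SM-independent CauchyReals.commutativeRing d , SM-rank CauchyReals.commutativeRing d
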